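{- Let $H$ be a graph with $m$ edges and no isolated vertices and let $k$ be a positive integer. If $k\geq \frac{\log(m+1)}{m\log(1+1/m)}$, then $\beta_B(H,k)=m^{ -km}$.
   Context: For a finite set $X$, $\mathcal{C}(X,H)$ is the set of subgraphs of the complete graph on $X$ isomorphic to $H$. For a probability mass $\mu$ on $\binom{X}{2}$ and a subgraph $G$ of the complete graph on $X$, $\mu(G)=\prod_{e\in E(G)}\mu(e)$. For a graph $H$ without isolated vertices and a positive integer $k$, $\beta_B(\mu;H,k)=\sum_{H'\in\mathcal{C}(X,H)}\mu(H')^k$ and $\beta_B(H,k)=\sup\beta_B(\mu;H,k)$ over all finite sets $X$ and probability masses $\mu$ on $\binom{X}{2}$.
   Formalization: The probability masses μ range over rational-valued masses instead of real-valued ones; the supremum is stated as an upper bound for all such masses together with a mass attaining it. -}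

module Defs where

open import Data.Nat using (ℕ; zero; suc; _<ᵇ_)
import Data.Nat as ℕ
open import Data.Bool using (Bool; true; false; _∧_; if_then_else_)
open import Data.Fin using (Fin; toℕ)
import Data.Fin as Fin
open import Data.Vec using (Vec; lookup)
open import Data.List using (List; []; _∷_)
open import Data.List.Membership.Propositional using (_∈_)
open import Data.List.Relation.Unary.Unique.Propositional using (Unique)
open import Data.Product using (Σ; _×_)
open import Data.Integer using (+_)
open import Data.Rational using (ℚ; 0ℚ; 1ℚ; _+_; _*_; _≤_; _/_)
open import Relation.Binary.PropositionalEquality using (_≡_)

sumℚ : (n : ℕ) → (Fin n → ℚ) → ℚ
sumℚ zero    f = 0ℚ
sumℚ (suc n) f = f Fin.zero + sumℚ n (λ i → f (Fin.suc i))

prodℚ : (n : ℕ) → (Fin n → ℚ) → ℚ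
prodℚ zero    f = 1ℚ
prodℚ (suc n) f = f Fin.zero * prodℚ n (λ i → f (Fin.suc i))

sumℕ : (n : ℕ) → (Fin n → ℕ) → ℕ
sumℕ zero    f = 0
sumℕ (suc n) f = f Fin.zero ℕ.+ sumℕ n (λ i → f (Fin.suc i))

powℚ : ℚ → ℕ → ℚ
powℚ q zero    = 1ℚ
powℚ q (suc e) = q * powℚ q e

-- m ^ (-e) as a rational; m = 0 is junk (0) and is excluded by hypothesis
invPow : ℕ → ℕ → ℚ
invPow zero    e = 0ℚ
invPow (suc m) e = powℚ ((+ 1) / suc m) e

Graph : ℕ → Set
Graph n = Vec (Vec Bool n) n

adj : {n : ℕ} → Graph n → Fin n → Fin n → Bool
adj G i j = lookup (lookup G i) j

IsSimple : {n : ℕ} → Graph n → Set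
IsSimple {n} G = ((i j : Fin n) → adj G i j ≡ adj G j i) × ((i : Fin n) → adj G i i ≡ false)

NoIsolated : {n : ℕ} → Graph n → Set
NoIsolated {n} G = (i : Fin n) → Σ (Fin n) (λ j → adj G i j ≡ true)

edgeCount : {n : ℕ} → Graph n → ℕ
edgeCount {n} G = sumℕ n (λ i → sumℕ n (λ j →
  if (adj G i j ∧ (toℕ i <ᵇ toℕ j)) then 1 else 0))

-- G (a subgraph of the complete graph on Fin N, given by its edge set;
-- its vertex set is the set of non-isolated vertices) is isomorphic to H:
-- its edge set is the image of E(H) under an injective vertex map.
IsCopy : {n N : ℕ} → Graph n → Graph N → Set
IsCopy {n} {N} H G = Σ (Fin n → Fin N) λ f →
  ((i j : Fin n) → f i ≡ f j → i ≡ j) ×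
  ((a b : Fin N) →
     (adj G a b ≡ true → Σ (Fin n) λ i → Σ (Fin n) λ j → f i ≡ a × f j ≡ b × adj H i j ≡ true) ×
     ((Σ (Fin n) λ i → Σ (Fin n) λ j → f i ≡ a × f j ≡ b × adj H i j ≡ true) → adj G a b ≡ true))

Enumerates : {n N : ℕ} → Graph n → List (Graph N) → Set
Enumerates {n} {N} H L = Unique L × ((G : Graph N) → (G ∈ L → IsCopy H G) × (IsCopy H G → G ∈ L))

-- a probability mass on the 2-subsets {a,b} of Fin N; the pair {a,b} with
-- toℕ a < toℕ b has mass μ a b (values of μ a b with toℕ a ≥ toℕ b are unused)
IsProbMass : {N : ℕ} → (Fin N → Fin N → ℚ) → Set
IsProbMass {N} μ =
  ((a b : Fin N) → toℕ a ℕ.< toℕ b → 0ℚ ≤ μ a b) ×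
  (sumℚ N (λ a → sumℚ N (λ b → if (toℕ a <ᵇ toℕ b) then μ a b else 0ℚ)) ≡ 1ℚ)

weight : {N : ℕ} → (Fin N → Fin N → ℚ) → Graph N → ℚ
weight {N} μ G = prodℚ N (λ a → prodℚ N (λ b →
  if (adj G a b ∧ (toℕ a <ᵇ toℕ b)) then μ a b else 1ℚ))

-- β_B(μ;H,k), computed from an enumeration L of C(Fin N, H)
betaList : {N : ℕ} → (Fin N → Fin N → ℚ) → ℕ → List (Graph N) → ℚ
betaList μ k []      = 0ℚ
betaList μ k (G ∷ L) = powℚ (weight μ G) k + betaList μ k L

{-# OPTIONS --safe #-}

-- A copy of H has m edges, so β_B(μ; H, k) is at most the elementary symmetric polynomial
-- e_m(x₁^k, …, x_M^k) of the masses x_i, and it suffices to show m^(km) e_m(x^k) ≤ (Σ x)^(km) for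
-- natural numbers x_i. Induct on M, and put c = (Σ x) / (m + 1).
-- If every x_i ≤ c, average over the deletion of one entry: the induction hypothesis bounds
-- each term by (Σ x − x_i)^(km), and convexity together with the hypothesis on k (the case of
-- m + 1 equal entries) bounds this by (Σ x)^(km − 1) (Σ x − m x_i).
-- If x > c > y are two entries, then for a fixed sum x + y the polynomial is convex in the
-- product x y, so it does not exceed the larger of its values at (x + y, 0) and (c, x + y − c).
-- Otherwise there are at most m entries, and the bound is the AM–GM inequality.
-- Equality holds for the uniform mass on the edges of H itself.

module Submission where

open import Defs

-- Let u be the share of the deleted entry in the sum. The averaging step needs (1 - u)^(km) <= 1 -
-- m u. The left side is convex in u and both sides are 1 at u = 0, so the inequality holds up to u
-- = 1/(m + 1) as soon as it holds there. At that point it reads (m + 1) m^(km) <= (m + 1)^(km),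
-- which is the hypothesis on k freed of logarithms. This is the origin of the threshold c. Beyond u
-- = 1/m the right side is negative, so large entries are the obstacle and have to be exchanged
-- away. A maximiser on the simplex would need compactness. Here no extremal point has to exist:
-- each of the two alternatives of an exchange makes progress by itself, towards a shorter list or
-- towards more entries equal to c, so a finite induction over natural numbers is enough. All
-- inequalities involved are homogeneous, hence nothing is lost by clearing denominators, and the
-- scaling that makes c an integer is harmless.

module PowerSums where

  open import Data.Nat
  open import Data.Nat.Properties
  open import Data.Nat.ListAction using (sum; product)
  open import Data.Nat.ListAction.Properties using (sum-↭)
  open import Data.Nat.Tactic.RingSolver using (solve-∀)
  open import Data.Bool using (true; false; if_then_else_)
  open import Data.List using (List; []; _∷_; map; length)
  open import Data.List.Properties using (length-map; map-∘; map-cong)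
  open import Data.List.Relation.Unary.All as All using (All; []; _∷_)
  import Data.List.Relation.Unary.All.Properties as Allₚ
  open import Data.List.Relation.Unary.Any using (Any; here; there; any?)
  open import Data.List.Relation.Binary.Permutation.Propositional as ↭ using (_↭_; prep; swap; ↭-sym)
  open import Data.List.Relation.Binary.Permutation.Propositional.Properties
    using (↭-length; All-resp-↭; map⁺)
  open import Data.Product using (∃; ∃₂; _×_; _,_; proj₁; proj₂)
  open import Data.Sum using (inj₁; inj₂)
  open import Relation.Nullary using (yes; no; does; contradiction)
  open import Relation.Nullary.Decidable using (dec-true; dec-false)
  open import Relation.Binary.PropositionalEquality
  open ≤-Reasoning

  -- Elementary symmetric polynomials of k-th powers

  ^-distribˡ-* : ∀ k a b → (a * b) ^ k ≡ a ^ k * b ^ k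
  ^-distribˡ-* zero    a b = refl
  ^-distribˡ-* (suc k) a b rewrite ^-distribˡ-* k a b = ring a b (a ^ k) (b ^ k)
    where
    ring : ∀ a b p q → a * b * (p * q) ≡ a * p * (b * q)
    ring = solve-∀

  esym : ℕ → ℕ → List ℕ → ℕ
  esym k zero    xs       = 1
  esym k (suc m) []       = 0
  esym k (suc m) (x ∷ xs) = esym k (suc m) xs + x ^ k * esym k m xs

  esym-↭ : ∀ k m {xs ys} → xs ↭ ys → esym k m xs ≡ esym k m ys
  esym-↭ k m       ↭.refl         = refl
  esym-↭ k zero    (prep x p)   = refl
  esym-↭ k (suc m) (prep x p)   = cong₂ (λ a b → a + x ^ k * b) (esym-↭ k (suc m) p) (esym-↭ k m p)
  esym-↭ k zero    (swap x y p) = refl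
  esym-↭ k (suc zero) (swap x y p) rewrite esym-↭ k 1 p = ring _ (x ^ k) (y ^ k)
    where
    ring : ∀ e a b → e + b * 1 + a * 1 ≡ e + a * 1 + b * 1
    ring = solve-∀
  esym-↭ k (suc (suc m)) (swap x y p)
    rewrite esym-↭ k (2 + m) p | esym-↭ k (1 + m) p | esym-↭ k m p = ring _ _ _ (x ^ k) (y ^ k)
    where
    ring : ∀ e₂ e₁ e₀ a b → e₂ + b * e₁ + a * (e₁ + b * e₀) ≡ e₂ + a * e₁ + b * (e₁ + a * e₀)
    ring = solve-∀
  esym-↭ k m       (↭.trans p q)  = trans (esym-↭ k m p) (esym-↭ k m q)

  -- The exponent is a successor because `0 ^ 0` is 1.
  esym-0∷ : ∀ k m xs → esym (suc k) m (0 ∷ xs) ≡ esym (suc k) m xs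
  esym-0∷ k zero    xs = refl
  esym-0∷ k (suc m) xs = +-identityʳ _

  -- `C`, `B`, `A` are the symmetric polynomials of `zs` of degrees m, m - 1, m - 2, with 0 in
  -- negative degree. Hiding them behind existentials lets the two-entry estimate ignore m.
  esym-∷∷ : ∀ k m zs → ∃ λ C → ∃₂ λ B A → ∀ x y →
            esym k m (x ∷ y ∷ zs) ≡ C + (x ^ k + y ^ k) * B + x ^ k * y ^ k * A
  esym-∷∷ k zero zs = 1 , 0 , 0 , λ x y → ring (x ^ k) (y ^ k)
    where
    ring : ∀ a b → 1 ≡ 1 + (a + b) * 0 + a * b * 0
    ring = solve-∀
  esym-∷∷ k (suc zero) zs = esym k 1 zs , 1 , 0 , λ x y → ring _ (x ^ k) (y ^ k)
    where
    ring : ∀ e a b → e + b * 1 + a * 1 ≡ e + (a + b) * 1 + a * b * 0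
    ring = solve-∀
  esym-∷∷ k (suc (suc m)) zs = esym k (2 + m) zs , esym k (1 + m) zs , esym k m zs ,
    λ x y → ring _ _ _ (x ^ k) (y ^ k)
    where
    ring : ∀ e₂ e₁ e₀ a b → e₂ + b * e₁ + a * (e₁ + b * e₀) ≡ e₂ + (a + b) * e₁ + a * b * e₀
    ring = solve-∀

  esym-scale : ∀ l k m xs → esym k m (map (l *_) xs) ≡ l ^ (k * m) * esym k m xs
  esym-scale l k zero    xs rewrite *-zeroʳ k = refl
  esym-scale l k (suc m) [] = sym (*-zeroʳ (l ^ (k * suc m)))
  esym-scale l k (suc m) (x ∷ xs)
    rewrite esym-scale l k (suc m) xs | esym-scale l k m xs | ^-distribˡ-* k l x
          | *-suc k m | ^-distribˡ-+-* l k (k * m) = ring (l ^ k) (l ^ (k * m)) _ (x ^ k) _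
    where
    ring : ∀ a b e y e′ → a * b * e + a * y * (b * e′) ≡ a * b * (e + y * e′)
    ring = solve-∀

  esym-short : ∀ k m xs → length xs < m → esym k m xs ≡ 0
  esym-short k (suc m) []       _ = refl
  esym-short k (suc m) (x ∷ xs) (s≤s lt)
    rewrite esym-short k (suc m) xs (m<n⇒m<1+n lt) | esym-short k m xs lt = *-zeroʳ (x ^ k)

  esym-full : ∀ k xs → esym k (length xs) xs ≡ product xs ^ k
  esym-full k []       = sym (^-zeroˡ k)
  esym-full k (x ∷ xs)
    rewrite esym-short k (suc (length xs)) xs ≤-refl | esym-full k xs = sym (^-distribˡ-* k x (product xs))

  -- Convexity in the product of two entries

  -- Convexity of z^j: the two pairs have the same sum and one lies inside the other. In the
  -- induction the common part `y` of each base uses the previous case, and the increments meet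
  -- powers that are at most the largest one.
  ^-split-≤ : ∀ y δ ε j → (y + ε) ^ j + (y + δ) ^ j ≤ (y + δ + ε) ^ j + y ^ j
  ^-split-≤ y δ ε zero    = ≤-refl
  ^-split-≤ y δ ε (suc j) = begin
    (y + ε) * z + (y + δ) * w         ≡⟨ ring₁ y δ ε z w ⟩
    y * (z + w) + (ε * z + δ * w)     ≤⟨ +-mono-≤ (*-monoʳ-≤ y (^-split-≤ y δ ε j))
                                          (+-mono-≤ (*-monoʳ-≤ ε z≤u) (*-monoʳ-≤ δ w≤u)) ⟩
    y * (u + v) + (ε * u + δ * u)     ≡⟨ ring₂ y δ ε u v ⟩
    (y + δ + ε) * u + y * v           ∎
    where
    u = (y + δ + ε) ^ j
    v = y ^ j
    w = (y + δ) ^ j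
    z = (y + ε) ^ j
    z≤u : z ≤ u
    z≤u = ^-monoˡ-≤ j (+-monoˡ-≤ ε (m≤m+n y δ))
    w≤u : w ≤ u
    w≤u = ^-monoˡ-≤ j (m≤m+n (y + δ) ε)
    ring₁ : ∀ y δ ε z w → (y + ε) * z + (y + δ) * w ≡ y * (z + w) + (ε * z + δ * w)
    ring₁ = solve-∀
    ring₂ : ∀ y δ ε u v → y * (u + v) + (ε * u + δ * u) ≡ (y + δ + ε) * u + y * v
    ring₂ = solve-∀

  -- The quotient ((x + y)^(k+1) − x^(k+1) − y^(k+1)) / (x y), with s standing for x + y.
  cross : ℕ → ℕ → ℕ → ℕ → ℕ
  cross s x y zero    = 0
  cross s x y (suc k) = s * cross s x y k + (x ^ k + y ^ k)

  ^-cross : ∀ x y k → (x + y) ^ suc k ≡ x ^ suc k + y ^ suc k + x * y * cross (x + y) x y k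
  ^-cross x y zero = ring x y
    where
    ring : ∀ x y → (x + y) * 1 ≡ x * 1 + y * 1 + x * y * 0
    ring = solve-∀
  ^-cross x y (suc k) = trans (cong ((x + y) *_) (^-cross x y k)) (ring x y (x ^ k) (y ^ k) (cross (x + y) x y k))
    where
    ring : ∀ x y a b q → (x + y) * (x * a + y * b + x * y * q)
                       ≡ x * (x * a) + y * (y * b) + x * y * ((x + y) * q + (a + b))
    ring = solve-∀

  -- This is the convexity of x^(k+1) + y^(k+1) in t = x y, seen through chords from t = 0: by
  -- `^-cross` their slope is minus `cross`, so it has to grow as the pair is balanced. Keeping `s`
  -- separate from the pair makes the two recursions comparable term by term.
  cross-≤ : ∀ s y δ ε k → cross s (y + δ) (y + ε) k ≤ cross s (y + δ + ε) y k
  cross-≤ s y δ ε zero    = z≤n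
  cross-≤ s y δ ε (suc k) = +-mono-≤ (*-monoʳ-≤ s (cross-≤ s y δ ε k))
    (≤-trans (≤-reflexive (+-comm ((y + δ) ^ k) _)) (^-split-≤ y δ ε k))

  *-spread : ∀ y δ ε → (y + δ) * (y + ε) ≡ (y + δ + ε) * y + δ * ε
  *-spread = solve-∀

  -- For a fixed sum x + y, both x^k + y^k and x^k y^k are convex functions of t = x y;
  -- this compares t = x y with t = 0 and with T = c d.
  pair-convex : ∀ k C B A y δ ε →
    let x = y + δ + ε; c = y + δ; d = y + ε
        F = λ a b → C + (a ^ suc k + b ^ suc k) * B + a ^ suc k * b ^ suc k * A
    in c * d * F x y + x * y * F (x + y) 0 ≤ c * d * F (x + y) 0 + x * y * F c d
  pair-convex k C B A y δ ε = begin
    T * (C + p * B + x ^ suc k * y ^ suc k * A) + t * (C + (X + 0) * B + X * 0 * A)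
      ≡⟨ ring₁ C B A T t p (x ^ suc k * y ^ suc k) X ⟩
    (T + t) * C + (T * p + t * X) * B + T * (x ^ suc k * y ^ suc k) * A
      ≤⟨ +-mono-≤ (+-monoʳ-≤ ((T + t) * C) (*-monoˡ-≤ B sums)) (*-monoˡ-≤ A prods) ⟩
    (T + t) * C + (T * X + t * r) * B + t * (c ^ suc k * d ^ suc k) * A
      ≡⟨ ring₂ C B A T t r (c ^ suc k * d ^ suc k) X ⟨
    T * (C + (X + 0) * B + X * 0 * A) + t * (C + r * B + c ^ suc k * d ^ suc k * A) ∎
    where
    x = y + δ + ε
    c = y + δ
    d = y + ε
    T = c * d
    t = x * y
    X = (x + y) ^ suc k
    p = x ^ suc k + y ^ suc k
    r = c ^ suc k + d ^ suc k
    same-sum : ∀ y δ ε → y + δ + ε + y ≡ (y + δ) + (y + ε)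
    same-sum = solve-∀
    t≤T : t ≤ T
    t≤T = ≤-trans (m≤m+n t (δ * ε)) (≤-reflexive (sym (*-spread y δ ε)))
    qx = cross (x + y) x y k
    qc = cross (x + y) c d k
    X≡r : X ≡ r + T * qc
    X≡r = trans (cong (_^ suc k) (same-sum y δ ε))
         (trans (^-cross c d k) (cong (λ s → r + T * cross s c d k) (sym (same-sum y δ ε))))
    ring₁ : ∀ C B A T t p π X → T * (C + p * B + π * A) + t * (C + (X + 0) * B + X * 0 * A)
                              ≡ (T + t) * C + (T * p + t * X) * B + T * π * A
    ring₁ = solve-∀
    ring₂ : ∀ C B A T t r π X → T * (C + (X + 0) * B + X * 0 * A) + t * (C + r * B + π * A)
                              ≡ (T + t) * C + (T * X + t * r) * B + t * π * A
    ring₂ = solve-∀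
    ring₃ : ∀ T t p r q → T * p + t * (r + T * q) ≡ T * (p + t * q) + t * r
    ring₃ = solve-∀
    -- `X` equals both `r + T * qc` and `p + t * qx`. Expanding it by the first form on the left and
    -- by the second on the right leaves `qc ≤ qx`.
    sums : T * p + t * X ≤ T * X + t * r
    sums = begin
      T * p + t * X             ≡⟨ cong (λ z → T * p + t * z) X≡r ⟩
      T * p + t * (r + T * qc)  ≡⟨ ring₃ T t p r qc ⟩
      T * (p + t * qc) + t * r  ≤⟨ +-monoˡ-≤ (t * r) (*-monoʳ-≤ T (+-monoʳ-≤ p (*-monoʳ-≤ t
                                     (cross-≤ (x + y) y δ ε k)))) ⟩
      T * (p + t * qx) + t * r  ≡⟨ cong (λ z → T * z + t * r) (^-cross x y k) ⟨
      T * X + t * r             ∎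
    ring₄ : ∀ T t a → T * (t * a) ≡ t * (T * a)
    ring₄ = solve-∀
    prods : T * (x ^ suc k * y ^ suc k) ≤ t * (c ^ suc k * d ^ suc k)
    prods = begin
      T * (x ^ suc k * y ^ suc k) ≡⟨ cong (T *_) (^-distribˡ-* (suc k) x y) ⟨
      T * (t * t ^ k)             ≡⟨ ring₄ T t (t ^ k) ⟩
      t * (T * t ^ k)             ≤⟨ *-monoʳ-≤ t (*-monoʳ-≤ T (^-monoˡ-≤ k t≤T)) ⟩
      t * (T * T ^ k)             ≡⟨ cong (t *_) (^-distribˡ-* (suc k) c d) ⟩
      t * (c ^ suc k * d ^ suc k) ∎

  -- Since T = t + δ ε, `pair-convex` bounds T F by δ ε F₀ + t F₂: the value at the given pair is at
  -- most an average of the values at the merged and the balanced pair, with weights δ ε and t.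
  exchange : ∀ k m zs g R y δ ε .{{_ : NonZero ((y + δ) * (y + ε))}} →
    g * esym (suc k) m (y + δ + ε + y ∷ zs) ≤ R →
    g * esym (suc k) m (y + δ ∷ y + ε ∷ zs) ≤ R →
    g * esym (suc k) m (y + δ + ε ∷ y ∷ zs) ≤ R
  exchange k m zs g R y δ ε F₀≤R F₂≤R = *-cancelˡ-≤ T (+-cancelʳ-≤ (t * (g * F₀)) _ _ (begin
      T * (g * F) + t * (g * F₀)                    ≡⟨ ring₁ T t g F F₀ ⟩
      g * (T * F + t * F₀)                          ≤⟨ *-monoʳ-≤ g convex ⟩
      g * (T * F₀ + t * F₂)                         ≡⟨ cong (λ z → g * (z * F₀ + t * F₂)) (*-spread y δ ε) ⟩
      g * ((t + δ * ε) * F₀ + t * F₂)               ≡⟨ ring₂ t (δ * ε) g F₀ F₂ ⟩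
      δ * ε * (g * F₀) + t * (g * F₂) + t * (g * F₀) ≤⟨ +-monoˡ-≤ (t * (g * F₀)) (+-mono-≤ (*-monoʳ-≤ (δ * ε) F₀≤R) (*-monoʳ-≤ t F₂≤R)) ⟩
      δ * ε * R + t * R + t * (g * F₀)              ≡⟨ cong (_+ t * (g * F₀)) (ring₃ t (δ * ε) R) ⟩
      (t + δ * ε) * R + t * (g * F₀)                ≡⟨ cong (λ z → z * R + t * (g * F₀)) (*-spread y δ ε) ⟨
      T * R + t * (g * F₀)                          ∎))
    where
    T = (y + δ) * (y + ε)
    t = (y + δ + ε) * y
    F  = esym (suc k) m (y + δ + ε ∷ y ∷ zs)
    F₀ = esym (suc k) m (y + δ + ε + y ∷ zs)
    F₂ = esym (suc k) m (y + δ ∷ y + ε ∷ zs)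
    -- The merged list has one entry fewer; a 0 in second place gives it the shape that `esym-∷∷`
    -- expands.
    merged : F₀ ≡ esym (suc k) m (y + δ + ε + y ∷ 0 ∷ zs)
    merged = trans (sym (esym-0∷ k m (y + δ + ε + y ∷ zs))) (esym-↭ (suc k) m (swap 0 _ ↭.refl))
    convex : T * F + t * F₀ ≤ T * F₀ + t * F₂
    convex with C , B , A , expand ← esym-∷∷ (suc k) m zs
      rewrite merged | expand (y + δ + ε) y | expand (y + δ + ε + y) 0 | expand (y + δ) (y + ε)
      = pair-convex k C B A y δ ε
    ring₁ : ∀ T t g F F₀ → T * (g * F) + t * (g * F₀) ≡ g * (T * F + t * F₀)
    ring₁ = solve-∀
    ring₂ : ∀ t r g F₀ F₂ → g * ((t + r) * F₀ + t * F₂) ≡ r * (g * F₀) + t * (g * F₂) + t * (g * F₀)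
    ring₂ = solve-∀
    ring₃ : ∀ t r R → r * R + t * R ≡ (t + r) * R
    ring₃ = solve-∀

  -- Bernoulli, AM-GM and the chord inequality

  2ya≤y²+a² : ∀ y a → 2 * (y * a) ≤ y * y + a * a
  2ya≤y²+a² y a with ≤-total y a
  ... | inj₁ y≤a rewrite sym (m+[n∸m]≡n y≤a) =
    ≤-trans (m≤m+n _ ((a ∸ y) * (a ∸ y))) (≤-reflexive (ring y (a ∸ y)))
    where
    ring : ∀ y r → 2 * (y * (y + r)) + r * r ≡ y * y + (y + r) * (y + r)
    ring = solve-∀
  ... | inj₂ a≤y rewrite sym (m+[n∸m]≡n a≤y) =
    ≤-trans (m≤m+n _ ((y ∸ a) * (y ∸ a))) (≤-reflexive (ring a (y ∸ a)))
    where
    ring : ∀ a r → 2 * ((a + r) * a) + r * r ≡ (a + r) * (a + r) + a * a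
    ring = solve-∀

  -- The tangent to y^(n+1) at y = a, with all terms kept positive. The inductive step multiplies by
  -- `y` and pays for the mixed product y a with a sum of two squares.
  bernoulli : ∀ n y a → suc n * (y * a ^ n) ≤ y ^ suc n + n * a ^ suc n
  bernoulli zero    y a = ≤-reflexive (ring y)
    where
    ring : ∀ y → 1 * (y * 1) ≡ y * 1 + 0
    ring = solve-∀
  bernoulli (suc n) y a = +-cancelʳ-≤ (n * (a * P) * y) _ _ (begin
    suc (suc n) * (y * (a * P)) + n * (a * P) * y    ≡⟨ ring₁ n y a P ⟩
    suc n * P * (2 * (y * a))                        ≤⟨ *-monoʳ-≤ (suc n * P) (2ya≤y²+a² y a) ⟩
    suc n * P * (y * y + a * a)                      ≡⟨ ring₂ n y a P ⟩
    y * (suc n * (y * P)) + suc n * (a * (a * P))    ≤⟨ +-monoˡ-≤ _ (*-monoʳ-≤ y (bernoulli n y a)) ⟩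
    y * (Y + n * (a * P)) + suc n * (a * (a * P))    ≡⟨ ring₃ n y a P Y ⟩
    y * Y + suc n * (a * (a * P)) + n * (a * P) * y  ∎)
    where
    P = a ^ n
    Y = y ^ suc n
    ring₁ : ∀ n y a P → suc (suc n) * (y * (a * P)) + n * (a * P) * y ≡ suc n * P * (2 * (y * a))
    ring₁ = solve-∀
    ring₂ : ∀ n y a P → suc n * P * (y * y + a * a) ≡ y * (suc n * (y * P)) + suc n * (a * (a * P))
    ring₂ = solve-∀
    ring₃ : ∀ n y a P Y → y * (Y + n * (a * P)) + suc n * (a * (a * P))
                        ≡ y * Y + suc n * (a * (a * P)) + n * (a * P) * y
    ring₃ = solve-∀

  -- Bernoulli at y = n (x + s), a = (n + 1) s.
  amgm-step : ∀ n x s → suc n ^ suc n * (x * s ^ n) ≤ n ^ n * (x + s) ^ suc n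
  amgm-step zero    x s = ≤-trans (m≤m+n _ s) (≤-reflexive (ring x s))
    where
    ring : ∀ x s → 1 * (x * 1) + s ≡ 1 * ((x + s) * 1)
    ring = solve-∀
  amgm-step n@(suc _) x s = *-cancelˡ-≤ n (+-cancelʳ-≤ (n * (M * (s * (q * S)))) _ _ (begin
    n * (M * q * (x * S)) + n * (M * (s * (q * S)))    ≡⟨ ring₁ n M q x s S ⟩
    M * (n * (x + s) * (q * S))                        ≡⟨ cong (λ z → M * (n * (x + s) * z)) (^-distribˡ-* n M s) ⟨
    M * (n * (x + s) * (M * s) ^ n)                    ≤⟨ bernoulli n (n * (x + s)) (M * s) ⟩
    (n * (x + s)) ^ suc n + n * (M * s) ^ suc n        ≡⟨ cong₂ (λ u v → u + n * (M * s * v))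
                                                            (^-distribˡ-* (suc n) n (x + s)) (^-distribˡ-* n M s) ⟩
    n ^ suc n * Z + n * (M * s * (q * S))              ≡⟨ ring₂ n (n ^ n) Z M s (q * S) ⟩
    n * (n ^ n * Z) + n * (M * (s * (q * S)))          ∎))
    where
    M = suc n
    q = M ^ n
    S = s ^ n
    Z = (x + s) ^ suc n
    ring₁ : ∀ n M q x s S → n * (M * q * (x * S)) + n * (M * (s * (q * S))) ≡ M * (n * (x + s) * (q * S))
    ring₁ = solve-∀
    ring₂ : ∀ n N Z M s u → n * N * Z + n * (M * s * u) ≡ n * (N * Z) + n * (M * (s * u))
    ring₂ = solve-∀

  amgm : ∀ xs → length xs ^ length xs * product xs ≤ sum xs ^ length xs
  amgm []       = ≤-refl
  amgm (x ∷ xs) = *-cancelˡ-≤ N {{m^n≢0′ n}} (begin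
    N * (suc n ^ suc n * (x * product xs)) ≡⟨ ring N (suc n ^ suc n) x (product xs) ⟩
    suc n ^ suc n * (x * (N * product xs)) ≤⟨ *-monoʳ-≤ (suc n ^ suc n) (*-monoʳ-≤ x (amgm xs)) ⟩
    suc n ^ suc n * (x * sum xs ^ n)       ≤⟨ amgm-step n x (sum xs) ⟩
    N * (x + sum xs) ^ suc n               ∎)
    where
    n = length xs
    N = n ^ n
    -- Since `0 ^ 0` is 1, the factor can also be cancelled when the tail is empty.
    m^n≢0′ : ∀ n → NonZero (n ^ n)
    m^n≢0′ zero    = _
    m^n≢0′ (suc n) = m^n≢0 (suc n) (suc n)
    ring : ∀ N M x p → N * (M * (x * p)) ≡ M * (x * (N * p))
    ring = solve-∀

  -- Convexity of z ↦ z^(j+1), at the points q + 1 and q with weights a and b.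
  jensen : ∀ q a b j → (a * suc q + b * q) ^ suc j ≤ (a + b) ^ j * (a * suc q ^ suc j + b * q ^ suc j)
  jensen q a b zero    = ≤-reflexive (ring q a b)
    where
    ring : ∀ q a b → (a * suc q + b * q) * 1 ≡ 1 * (a * (suc q * 1) + b * (q * 1))
    ring = solve-∀
  jensen q a b (suc j) = begin
    w * w ^ suc j                           ≤⟨ *-monoʳ-≤ w (jensen q a b j) ⟩
    w * (S * (a * P + b * Q))               ≡⟨ ring₁ q a b S P Q ⟩
    S * (a * a * (suc q * P) + b * b * (q * Q) + a * b * (q * P + q * Q + Q))
      ≤⟨ *-monoʳ-≤ S (+-monoʳ-≤ _ (*-monoʳ-≤ (a * b) (+-monoʳ-≤ (q * P + q * Q) (^-monoˡ-≤ (suc j) (n≤1+n q))))) ⟩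
    S * (a * a * (suc q * P) + b * b * (q * Q) + a * b * (q * P + q * Q + P))
      ≡⟨ ring₂ q a b S P Q ⟩
    (a + b) * S * (a * (suc q * P) + b * (q * Q)) ∎
    where
    w = a * suc q + b * q
    S = (a + b) ^ j
    P = suc q ^ suc j
    Q = q ^ suc j
    ring₁ : ∀ q a b S P Q → (a * suc q + b * q) * (S * (a * P + b * Q))
          ≡ S * (a * a * (suc q * P) + b * b * (q * Q) + a * b * (q * P + q * Q + Q))
    ring₁ = solve-∀
    ring₂ : ∀ q a b S P Q → S * (a * a * (suc q * P) + b * b * (q * Q) + a * b * (q * P + q * Q + P))
          ≡ (a + b) * S * (a * (suc q * P) + b * (q * Q))
    ring₂ = solve-∀

  -- In terms of u = y / (y + b) this says (1 − u)^(j+1) ≤ 1 − m u for 0 ≤ u ≤ 1 / (m + 1): the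
  -- convex left side lies below its chord, whose right end is controlled by the hypothesis.
  chord : ∀ m j → suc m * m ^ suc j ≤ suc m ^ suc j → ∀ y b → m * y ≤ b →
          b ^ suc j + m * y * (y + b) ^ j ≤ (y + b) ^ suc j
  chord m j hyp y b my≤b rewrite sym (m+[n∸m]≡n my≤b) =
    *-cancelˡ-≤ W {{m^n≢0 (suc m) (suc j)}} (begin
    W * (B ^ suc j + m * y * s ^ j)                ≡⟨ *-distribˡ-+ W _ _ ⟩
    W * B ^ suc j + W * (m * y * s ^ j)            ≡⟨ cong (_+ W * (m * y * s ^ j)) (^-distribˡ-* (suc j) (suc m) B) ⟨
    (suc m * B) ^ suc j + W * (m * y * s ^ j)      ≡⟨ cong (λ z → z ^ suc j + W * (m * y * s ^ j)) (ring₁ m y r) ⟩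
    -- Times m + 1, `B` is a combination of the points m + 1 and m with weights `r` and (m + 1) y,
    -- whose total is `s`. The two points are the ends u = 0 and u = 1 / (m + 1) of the chord.
    (r * suc m + suc m * y * m) ^ suc j + W * (m * y * s ^ j)
      ≤⟨ +-monoˡ-≤ _ (jensen m r (suc m * y) j) ⟩
    (r + suc m * y) ^ j * (r * W + suc m * y * m ^ suc j) + W * (m * y * s ^ j)
      ≡⟨ cong₂ (λ z u → z ^ j * (r * W + u) + W * (m * y * s ^ j)) (ring₂ m y r) (ring₃ m y (m ^ suc j)) ⟩
    s ^ j * (r * W + y * (suc m * m ^ suc j)) + W * (m * y * s ^ j)
      ≤⟨ +-monoˡ-≤ _ (*-monoʳ-≤ (s ^ j) (+-monoʳ-≤ (r * W) (*-monoʳ-≤ y hyp))) ⟩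
    s ^ j * (r * W + y * W) + W * (m * y * s ^ j)  ≡⟨ ring₄ m y r (s ^ j) W ⟩
    W * (s * s ^ j)                                ∎)
    where
    r = b ∸ m * y
    B = m * y + r
    s = y + B
    W = suc m ^ suc j
    ring₁ : ∀ m y r → suc m * (m * y + r) ≡ r * suc m + suc m * y * m
    ring₁ = solve-∀
    ring₂ : ∀ m y r → r + suc m * y ≡ y + (m * y + r)
    ring₂ = solve-∀
    ring₃ : ∀ m y p → suc m * y * p ≡ y * (suc m * p)
    ring₃ = solve-∀
    ring₄ : ∀ m y r S W → S * (r * W + y * W) + W * (m * y * S) ≡ W * ((y + (m * y + r)) * S)
    ring₄ = solve-∀

  -- Averaging over deletions

  deletions : List ℕ → List (ℕ × List ℕ)
  deletions []       = []
  deletions (x ∷ xs) = (x , xs) ∷ map (λ p → proj₁ p , x ∷ proj₂ p) (deletions xs)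

  map-proj₁-deletions : ∀ xs → map proj₁ (deletions xs) ≡ xs
  map-proj₁-deletions []       = refl
  map-proj₁-deletions (x ∷ xs) = cong (x ∷_) (trans (sym (map-∘ (deletions xs))) (map-proj₁-deletions xs))

  deletions-↭ : ∀ xs → All (λ p → proj₁ p ∷ proj₂ p ↭ xs) (deletions xs)
  deletions-↭ []       = []
  deletions-↭ (x ∷ xs) = ↭.refl ∷ Allₚ.map⁺ (All.map (λ p → ↭.trans (swap _ x ↭.refl) (prep x p)) (deletions-↭ xs))

  sum-map-+* : ∀ {A : Set} (f g : A → ℕ) a b xs →
    sum (map (λ x → a * f x + b * g x) xs) ≡ a * sum (map f xs) + b * sum (map g xs)
  sum-map-+* f g a b [] rewrite *-zeroʳ a = sym (*-zeroʳ b)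
  sum-map-+* f g a b (x ∷ xs) rewrite sum-map-+* f g a b xs = ring a b (f x) (g x) _ _
    where
    ring : ∀ a b u v s t → a * u + b * v + (a * s + b * t) ≡ a * (u + s) + b * (v + t)
    ring = solve-∀

  sum-map-≤ : ∀ {A : Set} {f : A → ℕ} {B xs} → All (λ x → f x ≤ B) xs → sum (map f xs) ≤ length xs * B
  sum-map-≤ []       = z≤n
  sum-map-≤ (p ∷ ps) = +-mono-≤ p (sum-map-≤ ps)

  -- A choice of m entries survives exactly the deletions of the entries outside it, `length xs`
  -- minus m of them; adding the m remaining copies on the left avoids the subtraction.
  esym-deletions : ∀ k m xs →
    sum (map (λ p → esym k m (proj₂ p)) (deletions xs)) + m * esym k m xs ≡ length xs * esym k m xs
  esym-deletions k zero    []       = refl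
  esym-deletions k (suc m) []       = *-zeroʳ (suc m)
  esym-deletions k zero    (x ∷ xs) = begin-equality
    1 + sum (map _ (map _ (deletions xs))) + 0 ≡⟨ cong (λ z → 1 + sum z + 0) (map-∘ (deletions xs)) ⟨
    1 + sum (map (λ _ → 1) (deletions xs)) + 0 ≡⟨ cong suc (esym-deletions k zero xs) ⟩
    1 + length xs * 1                          ∎
  esym-deletions k (suc m) (x ∷ xs) = begin-equality
    e₁ + sum (map _ (map _ (deletions xs))) + suc m * (e₁ + x ^ k * e₀)
      ≡⟨ cong (λ z → e₁ + sum z + suc m * (e₁ + x ^ k * e₀)) (trans (sym (map-∘ (deletions xs)))
           (map-cong (λ p → cong (_+ x ^ k * esym k m (proj₂ p)) (sym (*-identityˡ _))) (deletions xs))) ⟩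
    e₁ + sum (map (λ p → 1 * esym k (suc m) (proj₂ p) + x ^ k * esym k m (proj₂ p)) (deletions xs))
      + suc m * (e₁ + x ^ k * e₀)
      ≡⟨ cong (λ z → e₁ + z + suc m * (e₁ + x ^ k * e₀))
           (sum-map-+* (λ p → esym k (suc m) (proj₂ p)) (λ p → esym k m (proj₂ p)) 1 (x ^ k) (deletions xs)) ⟩
    e₁ + (1 * D₁ + x ^ k * D₀) + suc m * (e₁ + x ^ k * e₀)
      ≡⟨ ring₁ e₁ e₀ D₁ D₀ (x ^ k) m ⟩
    (D₁ + suc m * e₁) + x ^ k * (D₀ + m * e₀) + (e₁ + x ^ k * e₀)
      ≡⟨ cong₂ (λ u v → u + x ^ k * v + (e₁ + x ^ k * e₀)) (esym-deletions k (suc m) xs) (esym-deletions k m xs) ⟩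
    length xs * e₁ + x ^ k * (length xs * e₀) + (e₁ + x ^ k * e₀)
      ≡⟨ ring₂ e₁ e₀ (x ^ k) (length xs) ⟩
    suc (length xs) * (e₁ + x ^ k * e₀) ∎
    where
    e₁ = esym k (suc m) xs
    e₀ = esym k m xs
    D₁ = sum (map (λ p → esym k (suc m) (proj₂ p)) (deletions xs))
    D₀ = sum (map (λ p → esym k m (proj₂ p)) (deletions xs))
    ring₁ : ∀ e₁ e₀ D₁ D₀ a m → e₁ + (1 * D₁ + a * D₀) + suc m * (e₁ + a * e₀)
          ≡ (D₁ + suc m * e₁) + a * (D₀ + m * e₀) + (e₁ + a * e₀)
    ring₁ = solve-∀
    ring₂ : ∀ e₁ e₀ a l → l * e₁ + a * (l * e₀) + (e₁ + a * e₀) ≡ suc l * (e₁ + a * e₀)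
    ring₂ = solve-∀

  -- The inequality for natural numbers

  extract : ∀ {P : ℕ → Set} {xs} → Any P xs → ∃₂ λ x ys → P x × xs ↭ x ∷ ys
  extract (here {xs = xs} px) = _ , xs , px , ↭.refl
  extract (there {x = z} p) with x , ys , px , xs↭ ← extract p =
    x , z ∷ ys , px , ↭.trans (prep z xs↭) (swap z x ↭.refl)

  -- The termination measure for exchanges that keep the length.
  off : ℕ → List ℕ → ℕ
  off c xs = sum (map (λ x → if does (x ≟ c) then 0 else 1) xs)

  off-↭ : ∀ c {xs ys} → xs ↭ ys → off c xs ≡ off c ys
  off-↭ c p = sum-↭ (map⁺ _ p)

  -- Two entries different from `c` are replaced by a pair with at most one such entry, whether or
  -- not `d` happens to be `c`.
  off-exchange : ∀ {c x y} d zs → x ≢ c → y ≢ c → off c (c ∷ d ∷ zs) < off c (x ∷ y ∷ zs)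
  off-exchange {c} {x} {y} d zs x≢c y≢c
    rewrite dec-true (c ≟ c) refl | dec-false (x ≟ c) x≢c | dec-false (y ≟ c) y≢c
    with does (d ≟ c)
  ... | true  = s≤s (n≤1+n _)
  ... | false = ≤-refl

  sum-≥ : ∀ {c xs} → All (c ≤_) xs → length xs * c ≤ sum xs
  sum-≥ []       = z≤n
  sum-≥ (p ∷ ps) = +-mono-≤ p (sum-≥ ps)

  sum-map-* : ∀ l xs → sum (map (l *_) xs) ≡ l * sum xs
  sum-map-* l []       = sym (*-zeroʳ l)
  sum-map-* l (x ∷ xs) rewrite sum-map-* l xs = sym (*-distribˡ-+ l x (sum xs))

  -- The predecessor of suc k * suc m.
  degree-1 : ℕ → ℕ → ℕ
  degree-1 k m = m + k * suc m

  module _ (k m : ℕ) (hyp : suc (suc m) * suc m ^ suc (degree-1 k m) ≤ suc (suc m) ^ suc (degree-1 k m)) where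

    private
      K : ℕ
      K = degree-1 k m

    -- In this module `suc k` and `suc m` play the roles of k and m in the overview, so `suc K` is
    -- the degree km and m + 1 becomes `suc (suc m)`.
    Bounded : List ℕ → Set
    Bounded xs = suc m ^ suc K * esym (suc k) (suc m) xs ≤ sum xs ^ suc K

    -- With fewer than `suc m` entries there is no monomial. With exactly `suc m` the only one is
    -- the full product, and the claim is AM-GM raised to the power `suc k`.
    bounded-short : ∀ xs → length xs ≤ suc m → Bounded xs
    bounded-short xs len with m≤n⇒m<n∨m≡n len
    ... | inj₁ lt rewrite esym-short (suc k) (suc m) xs lt | *-zeroʳ (suc m ^ suc K) = z≤n
    ... | inj₂ eq = begin
      suc m ^ suc K * esym (suc k) (suc m) xs          ≡⟨ cong₂ (λ z l → z * esym (suc k) l xs) (power (suc m)) (sym eq) ⟩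
      (suc m ^ suc m) ^ suc k * esym (suc k) (length xs) xs ≡⟨ cong₂ _*_ (cong (λ l → (l ^ l) ^ suc k) (sym eq)) (esym-full (suc k) xs) ⟩
      (length xs ^ length xs) ^ suc k * product xs ^ suc k ≡⟨ ^-distribˡ-* (suc k) (length xs ^ length xs) (product xs) ⟨
      (length xs ^ length xs * product xs) ^ suc k     ≤⟨ ^-monoˡ-≤ (suc k) (amgm xs) ⟩
      (sum xs ^ length xs) ^ suc k                     ≡⟨ cong (λ l → (sum xs ^ l) ^ suc k) eq ⟩
      (sum xs ^ suc m) ^ suc k                         ≡⟨ power (sum xs) ⟨
      sum xs ^ suc K                                   ∎
      where
      power : ∀ a → a ^ suc K ≡ (a ^ suc m) ^ suc k
      power a = trans (cong (a ^_) (*-comm (suc k) (suc m))) (sym (^-*-assoc a (suc m) (suc k)))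

    -- Let n = `length xs` and M = `suc m`. Summed over all deletions, the terms M s^K y add up to M
    -- s^(K+1), and `esym-deletions` turns the rest into n - M copies of `G * E`. What remains is (n
    -- - M) G E ≤ (n - M) s^(K+1), and n - M is positive.
    bounded-flat : ∀ {l c} xs → length xs ≡ suc l → suc m ≤ l → sum xs ≡ suc (suc m) * c → All (_≤ c) xs →
                   (∀ ys → length ys ≡ l → Bounded ys) → Bounded xs
    bounded-flat {l} {c} xs len m<l total small IH = *-cancelˡ-≤ r {{>-nonZero (m<n⇒0<n∸m (s≤s m<l))}}
      (+-cancelʳ-≤ (suc m * (G * E) + suc m * s ^ suc K) _ _ (begin
      r * (G * E) + (suc m * (G * E) + suc m * s ^ suc K)   ≡⟨ ring₁ r (suc m) (G * E) (s ^ suc K) ⟩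
      (suc m + r) * (G * E) + suc m * s ^ suc K             ≡⟨ cong (λ z → z * (G * E) + suc m * s ^ suc K) split ⟩
      length xs * (G * E) + suc m * s ^ suc K               ≡⟨ cong (_+ suc m * s ^ suc K) (ring₂ (length xs) G E) ⟩
      G * (length xs * E) + suc m * s ^ suc K               ≡⟨ cong (λ z → G * z + suc m * s ^ suc K) (esym-deletions (suc k) (suc m) xs) ⟨
      G * (D + suc m * E) + suc m * (s * s ^ K)             ≡⟨ ring₃ G D (suc m) E s (s ^ K) ⟩
      (G * D + suc m * s ^ K * s) + suc m * (G * E)         ≤⟨ +-monoˡ-≤ (suc m * (G * E)) averaged ⟩
      length xs * s ^ suc K + suc m * (G * E)               ≡⟨ cong (λ z → z * s ^ suc K + suc m * (G * E)) split ⟨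
      (suc m + r) * s ^ suc K + suc m * (G * E)             ≡⟨ ring₄ (suc m) r (s ^ suc K) (G * E) ⟩
      r * s ^ suc K + (suc m * (G * E) + suc m * s ^ suc K) ∎))
      where
      s = sum xs
      r = suc l ∸ suc m
      G = suc m ^ suc K
      E = esym (suc k) (suc m) xs
      D = sum (map (λ p → esym (suc k) (suc m) (proj₂ p)) (deletions xs))
      split : suc m + r ≡ length xs
      split = trans (m+[n∸m]≡n (m≤n⇒m≤1+n m<l)) (sym len)
      ring₁ : ∀ r M x y → r * x + (M * x + M * y) ≡ (M + r) * x + M * y
      ring₁ = solve-∀
      ring₂ : ∀ n G E → n * (G * E) ≡ G * (n * E)
      ring₂ = solve-∀
      ring₃ : ∀ G D M E s S → G * (D + M * E) + M * (s * S) ≡ (G * D + M * S * s) + M * (G * E)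
      ring₃ = solve-∀
      ring₄ : ∀ M r x y → (M + r) * x + M * y ≡ r * x + (M * y + M * x)
      ring₄ = solve-∀
      each : All (λ p → G * esym (suc k) (suc m) (proj₂ p) + suc m * s ^ K * proj₁ p ≤ s ^ suc K) (deletions xs)
      each = All.map bound (deletions-↭ xs)
        where
        ring : ∀ M S y → M * S * y ≡ M * y * S
        ring = solve-∀
        bound : ∀ {p} → proj₁ p ∷ proj₂ p ↭ xs →
                G * esym (suc k) (suc m) (proj₂ p) + suc m * s ^ K * proj₁ p ≤ s ^ suc K
        bound {y , ys} y∷ys↭xs = begin
          G * esym (suc k) (suc m) ys + suc m * s ^ K * y ≤⟨ +-monoˡ-≤ _ (IH ys (suc-injective (trans (↭-length y∷ys↭xs) len))) ⟩
          sum ys ^ suc K + suc m * s ^ K * y              ≡⟨ cong (sum ys ^ suc K +_) (ring (suc m) (s ^ K) y) ⟩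
          sum ys ^ suc K + suc m * y * s ^ K              ≡⟨ cong (λ z → sum ys ^ suc K + suc m * y * z ^ K) s≡ ⟨
          sum ys ^ suc K + suc m * y * (y + sum ys) ^ K   ≤⟨ chord (suc m) K hyp y (sum ys) my≤ ⟩
          (y + sum ys) ^ suc K                            ≡⟨ cong (_^ suc K) s≡ ⟩
          s ^ suc K                                       ∎
          where
          s≡ : y + sum ys ≡ s
          s≡ = sum-↭ y∷ys↭xs
          y≤c : y ≤ c
          y≤c = All.head (All-resp-↭ (↭-sym y∷ys↭xs) small)
          -- Since `c` is the sum divided by `suc (suc m)`, an entry of at most `c` lies in the
          -- range of `chord`.
          my≤ : suc m * y ≤ sum ys
          my≤ = +-cancelˡ-≤ y _ _ (begin
            suc (suc m) * y ≤⟨ *-monoʳ-≤ (suc (suc m)) y≤c ⟩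
            suc (suc m) * c ≡⟨ total ⟨
            s               ≡⟨ s≡ ⟨
            y + sum ys      ∎)
      averaged : G * D + suc m * s ^ K * s ≤ length xs * s ^ suc K
      averaged = begin
        G * D + suc m * s ^ K * s
          ≡⟨ cong (λ z → G * D + suc m * s ^ K * sum z) (map-proj₁-deletions xs) ⟨
        G * D + suc m * s ^ K * sum (map proj₁ (deletions xs))
          ≡⟨ sum-map-+* (λ p → esym (suc k) (suc m) (proj₂ p)) proj₁ G (suc m * s ^ K) (deletions xs) ⟨
        sum (map (λ p → G * esym (suc k) (suc m) (proj₂ p) + suc m * s ^ K * proj₁ p) (deletions xs))
          ≤⟨ sum-map-≤ each ⟩
        length (deletions xs) * s ^ suc K
          ≡⟨ cong (_* s ^ suc K) (trans (sym (length-map proj₁ (deletions xs))) (cong length (map-proj₁-deletions xs))) ⟩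
        length xs * s ^ suc K ∎

    -- Each exchange fixes one more entry at c, or shortens the list.
    bounded-balance : ∀ {l c} n xs → off c xs < n → length xs ≡ suc l → suc m ≤ l → sum xs ≡ suc (suc m) * c →
                      (∀ ys → length ys ≡ l → Bounded ys) → Bounded xs
    bounded-balance {l} {c} (suc n) xs off<n len m<l total IH with any? (c <?_) xs
    ... | no none = bounded-flat xs len m<l total (All.map ≮⇒≥ (Allₚ.¬Any⇒All¬ xs none)) IH
    ... | yes some with x , ys , c<x , xs↭ ← extract some with any? (_<? c) ys
    -- One entry above `c` and at least `suc m` others not below it would already exceed the total
    -- `suc (suc m) * c`.
    ...   | no none = contradiction total (>⇒≢ (begin-strict
      suc (suc m) * c      ≡⟨⟩
      c + suc m * c        ≤⟨ +-monoʳ-≤ c (*-monoˡ-≤ c m<l) ⟩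
      c + l * c            <⟨ +-monoˡ-< (l * c) c<x ⟩
      x + l * c            ≡⟨ cong (λ z → x + z * c) (suc-injective (trans (sym len) (↭-length xs↭))) ⟩
      x + length ys * c    ≤⟨ +-monoʳ-≤ x (sum-≥ (All.map ≮⇒≥ (Allₚ.¬Any⇒All¬ ys none))) ⟩
      x + sum ys           ≡⟨ sum-↭ xs↭ ⟨
      sum xs               ∎))
    ...   | yes some′ with y , zs , y<c , ys↭ ← extract some′
        = subst₂ (λ e s → suc m ^ suc K * e ≤ s ^ suc K) (sym (esym-↭ (suc k) (suc m) perm)) (sym (sum-↭ perm))
            (subst (λ x → Bounded (x ∷ y ∷ zs)) x≡
              -- With δ = c - y and ε = x - c the given pair is (x, y) and the balanced one is (c, x
              -- + y - c). The merged list falls to `IH`, the balanced one to the recursion on `n`.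
              (exchange k (suc m) zs (suc m ^ suc K) _ y (c ∸ y) (x ∸ c) {{cd≢0}}
                (subst (λ t → suc m ^ suc K * esym (suc k) (suc m) (y + (c ∸ y) + (x ∸ c) + y ∷ zs) ≤ t ^ suc K)
                   (+-assoc (y + (c ∸ y) + (x ∸ c)) y (sum zs)) (IH (y + (c ∸ y) + (x ∸ c) + y ∷ zs) len₁))
                (subst (λ t → suc m ^ suc K * esym (suc k) (suc m) (y + (c ∸ y) ∷ d ∷ zs) ≤ t ^ suc K)
                   sum₂ (subst (λ c′ → Bounded (c′ ∷ d ∷ zs)) (sym c≡) balanced))))
      where
      d = y + (x ∸ c)
      perm : xs ↭ x ∷ y ∷ zs
      perm = ↭.trans xs↭ (prep x ys↭)
      c≡ : y + (c ∸ y) ≡ c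
      c≡ = m+[n∸m]≡n (<⇒≤ y<c)
      x≡ : y + (c ∸ y) + (x ∸ c) ≡ x
      x≡ = trans (cong (_+ (x ∸ c)) c≡) (m+[n∸m]≡n (<⇒≤ c<x))
      len₁ : length (y + (c ∸ y) + (x ∸ c) + y ∷ zs) ≡ l
      len₁ = suc-injective (trans (sym (↭-length perm)) len)
      ring : ∀ y δ ε z → y + δ + (y + ε + z) ≡ y + δ + ε + (y + z)
      ring = solve-∀
      sum₂ : sum (y + (c ∸ y) ∷ d ∷ zs) ≡ sum (y + (c ∸ y) + (x ∸ c) ∷ y ∷ zs)
      sum₂ = ring y (c ∸ y) (x ∸ c) (sum zs)
      cd≢0 : NonZero ((y + (c ∸ y)) * d)
      cd≢0 = m*n≢0 _ _ {{>-nonZero (≤-trans (m<n⇒0<n∸m y<c) (m≤n+m _ y))}}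
                          {{>-nonZero (≤-trans (m<n⇒0<n∸m c<x) (m≤n+m _ y))}}
      balanced : Bounded (c ∷ d ∷ zs)
      balanced = bounded-balance n (c ∷ d ∷ zs)
        (≤-trans (off-exchange d zs (>⇒≢ c<x) (<⇒≢ y<c))
                 (≤-trans (≤-reflexive (sym (off-↭ c perm))) (s≤s⁻¹ off<n)))
        (trans (sym (↭-length perm)) len) m<l
        (trans (trans (cong (λ c′ → c′ + (d + sum zs)) (sym c≡))
          (trans sum₂ (cong (_+ (y + sum zs)) x≡))) (trans (sym (sum-↭ perm)) total)) IH

    -- Scaling the entries by m + 2 makes c = sum xs integral.
    bounded-length : ∀ l xs → length xs ≡ l → Bounded xs
    bounded-length zero    []  len = bounded-short [] z≤n
    bounded-length (suc l) xs len with suc m ≤? l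
    ... | no m≮l  = bounded-short xs (≤-trans (≤-reflexive len) (≰⇒> m≮l))
    ... | yes m<l = *-cancelˡ-≤ W {{m^n≢0 (2 + m) (suc K)}} (begin
      W * (G * esym (suc k) (suc m) xs)      ≡⟨ ring W G _ ⟩
      G * (W * esym (suc k) (suc m) xs)      ≡⟨ cong (G *_) (esym-scale (2 + m) (suc k) (suc m) xs) ⟨
      G * esym (suc k) (suc m) (map ((2 + m) *_) xs)
        -- `≤-refl` sets the recursion bound to one more than the initial number of entries
        -- different from `c`.
        ≤⟨ bounded-balance {c = sum xs} _ (map ((2 + m) *_) xs) ≤-refl (trans (length-map _ xs) len) m<l (sum-map-* (2 + m) xs)
             (bounded-length l) ⟩
      sum (map ((2 + m) *_) xs) ^ suc K      ≡⟨ cong (_^ suc K) (sum-map-* (2 + m) xs) ⟩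
      ((2 + m) * sum xs) ^ suc K             ≡⟨ ^-distribˡ-* (suc K) (2 + m) (sum xs) ⟩
      W * sum xs ^ suc K                     ∎)
      where
      W = (2 + m) ^ suc K
      G = suc m ^ suc K
      ring : ∀ W G e → W * (G * e) ≡ G * (W * e)
      ring = solve-∀

  -- The hypothesis is the conclusion for m + 1 entries equal to 1, so for this inequality on lists
  -- it is also necessary.
  esym-bound : ∀ k m → 1 ≤ k → 1 ≤ m → (m + 1) * m ^ (k * m) ≤ (m + 1) ^ (k * m) →
               ∀ xs → m ^ (k * m) * esym k m xs ≤ sum xs ^ (k * m)
  esym-bound (suc k) (suc m) _ _ hyp xs rewrite +-comm m 1 = bounded-length k m hyp (length xs) xs refl

-- Copies of a graph as m-subsets of the vertex pairs

module Counting where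

  open PowerSums
  open import Data.Nat
  open import Data.Nat.Properties
  open import Data.Nat.ListAction using (sum; product)
  open import Data.Nat.ListAction.Properties using (sum-++; product-++)
  open import Data.Nat.Tactic.RingSolver using (solve-∀)
  open import Data.Bool using (Bool; true; false; _∧_; if_then_else_; T)
  import Data.Bool as Bool
  open import Data.Bool.Properties using (∧-identityʳ)
  open import Data.Fin using (Fin; toℕ)
  import Data.Fin as Fin
  open import Data.Fin.Properties using (toℕ-injective)
  open import Data.Vec using (Vec; lookup)
  open import Data.Vec.Properties using (tabulate∘lookup; tabulate-cong)
  open import Data.List using (List; []; _∷_; map; length; filter; allFin; cartesianProduct)
  open import Data.List.Properties using (length-map; map-∘; map-tabulate; map-++; ∷-injectiveˡ; ∷-injectiveʳ)
  open import Data.List.Relation.Unary.All using (All; []; _∷_)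
  import Data.List.Relation.Unary.All as All
  import Data.List.Relation.Unary.All.Properties as Allₚ
  open import Data.List.Relation.Unary.Any using (here; there)
  open import Data.List.Relation.Unary.AllPairs using (AllPairs; []; _∷_)
  import Data.List.Relation.Unary.AllPairs.Properties as AllPairsₚ
  open import Data.List.Relation.Unary.Unique.Propositional using (Unique)
  import Data.List.Relation.Unary.Unique.Propositional.Properties as Uniqueₚ
  open import Data.List.Relation.Binary.Permutation.Propositional.Properties
    using (↭-length)
  open import Data.List.Relation.Binary.BagAndSetEquality using (∼bag⇒↭)
  open import Data.List.Membership.Propositional using (_∈_)
  open import Data.List.Membership.Propositional.Properties
    using (∈-cartesianProduct⁺; ∈-allFin; ∈-filter⁺; ∈-filter⁻; ∈-map⁺; ∈-map⁻)
  open import Data.List.Membership.Propositional.Properties.WithK using (unique∧set⇒bag)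
  open import Data.Product using (Σ; _×_; _,_; proj₁; proj₂; uncurry)
  open import Data.Product.Properties using (,-injective)
  open import Function using (mk⇔)
  open import Relation.Nullary using (¬_; contradiction)
  open import Relation.Binary.Definitions using (tri<; tri≈; tri>)
  open import Relation.Binary.PropositionalEquality
  open ≤-Reasoning

  module _ {A : Set} where

    subproduct : (A → ℕ) → (A → Bool) → List A → ℕ
    subproduct w v es = product (map (λ e → if v e then w e else 1) es)

    count : (A → Bool) → List A → ℕ
    count v es = sum (map (λ e → if v e then 1 else 0) es)

    -- Comparing value lists instead of functions avoids extensionality and ignores values outside
    -- `es`, so the relation passes to a tail once the values at the head agree.
    DifferOn : List A → (A → Bool) → (A → Bool) → Set
    DifferOn es v v′ = map v es ≢ map v′ es

    with-value : A → Bool → List (A → Bool) → List (A → Bool)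
    with-value e b = filter (λ v → v e Bool.≟ b)

    sum-with-value : ∀ e (f : (A → Bool) → ℕ) vs →
      sum (map f vs) ≡ sum (map f (with-value e false vs)) + sum (map f (with-value e true vs))
    sum-with-value e f []       = refl
    sum-with-value e f (v ∷ vs) with v e
    ... | false rewrite sum-with-value e f vs = sym (+-assoc (f v) _ _)
    ... | true  rewrite sum-with-value e f vs =
      ring (f v) (sum (map f (with-value e false vs))) (sum (map f (with-value e true vs)))
      where
      ring : ∀ a b c → a + (b + c) ≡ b + (a + c)
      ring = solve-∀

    differ-tail : ∀ {e es b vs} → All (λ v → v e ≡ b) vs →
                  AllPairs (DifferOn (e ∷ es)) vs → AllPairs (DifferOn es) vs
    differ-tail []       []       = []
    differ-tail (p ∷ ps) (q ∷ qs) =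
      All.zipWith (λ { (p′ , d) eq → d (cong₂ _∷_ (trans p (sym p′)) eq) }) (ps , q) ∷ differ-tail ps qs

    sum-map-*-All : ∀ (f g : (A → Bool) → ℕ) a {vs} → All (λ v → f v ≡ a * g v) vs →
                    sum (map f vs) ≡ a * sum (map g vs)
    sum-map-*-All f g a []       = sym (*-zeroʳ a)
    sum-map-*-All f g a (p ∷ ps) rewrite p | sum-map-*-All f g a ps = sym (*-distribˡ-+ a _ _)

    -- Distinct m-subsets of `es` select distinct monomials, and the monomials left out are
    -- nonnegative. Splitting the family by membership of the first element mirrors the recursion of
    -- `esym`.
    sum-subproduct-≤ : ∀ k m (w : A → ℕ) es vs → AllPairs (DifferOn es) vs → All (λ v → count v es ≡ m) vs →
                       sum (map (λ v → subproduct w v es ^ k) vs) ≤ esym k m (map w es)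
    sum-subproduct-≤ k m w [] []           _         _            = z≤n
    -- On the empty list all subsets coincide, so at most one is left, and its size forces m = 0.
    sum-subproduct-≤ k m w [] (v ∷ [])     _         (refl ∷ _) = ≤-reflexive (trans (+-identityʳ _) (^-zeroˡ k))
    sum-subproduct-≤ k m w [] (v ∷ _ ∷ _) ((d ∷ _) ∷ _) _       = contradiction refl d
    sum-subproduct-≤ k m w (e ∷ es) vs diff cnt = begin
      sum (map f vs)                                            ≡⟨ sum-with-value e f vs ⟩
      sum (map f vs₀) + sum (map f vs₁)                         ≡⟨ cong₂ _+_ (sum-map-*-All f g 1 (All.map (λ {v} → val₀ v) (vals false)))
                                                                             (sum-map-*-All f g (w e ^ k) (All.map (λ {v} → val₁ v) (vals true))) ⟩
      1 * sum (map g vs₀) + w e ^ k * sum (map g vs₁)           ≡⟨ cong (_+ w e ^ k * sum (map g vs₁)) (*-identityˡ _) ⟩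
      sum (map g vs₀) + w e ^ k * sum (map g vs₁)
        ≤⟨ +-monoˡ-≤ _ (sum-subproduct-≤ k m w es vs₀ (diffs false) (All.zipWith cnt₀ (vals false , cnts false))) ⟩
      esym k m (map w es) + w e ^ k * sum (map g vs₁)
        ≤⟨ last m vs₁ (diffs true) (vals true) (cnts true) ⟩
      esym k m (w e ∷ map w es) ∎
      where
      f = λ (v : A → Bool) → subproduct w v (e ∷ es) ^ k
      g = λ (v : A → Bool) → subproduct w v es ^ k
      vs₀ = with-value e false vs
      vs₁ = with-value e true vs
      vals : ∀ b → All (λ v → v e ≡ b) (with-value e b vs)
      vals b = Allₚ.all-filter (λ v → v e Bool.≟ b) vs
      diffs : ∀ b → AllPairs (DifferOn es) (with-value e b vs)
      diffs b = differ-tail (vals b) (AllPairsₚ.filter⁺ _ diff)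
      cnts : ∀ b → All (λ v → count v (e ∷ es) ≡ m) (with-value e b vs)
      cnts b = Allₚ.filter⁺ _ cnt
      val₀ : ∀ v → v e ≡ false → f v ≡ 1 * g v
      val₀ v p rewrite p | +-identityʳ (subproduct w v es) = sym (+-identityʳ _)
      val₁ : ∀ v → v e ≡ true → f v ≡ w e ^ k * g v
      val₁ v p rewrite p = ^-distribˡ-* k (w e) (subproduct w v es)
      cnt₀ : ∀ {m v} → v e ≡ false × count v (e ∷ es) ≡ m → count v es ≡ m
      cnt₀ (p , c) rewrite p = c
      cnt₁ : ∀ {m v} → v e ≡ true × count v (e ∷ es) ≡ m → suc (count v es) ≡ m
      cnt₁ (p , c) rewrite p = c
      -- The size is an argument here to allow a case split: for size 0 no subset contains `e`, and
      -- `esym k 0` has no term for it.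
      last : ∀ m vs → AllPairs (DifferOn es) vs → All (λ v → v e ≡ true) vs → All (λ v → count v (e ∷ es) ≡ m) vs →
             esym k m (map w es) + w e ^ k * sum (map g vs) ≤ esym k m (w e ∷ map w es)
      last zero    []       _ _       _       = ≤-reflexive (cong suc (*-zeroʳ (w e ^ k)))
      last zero    (v ∷ vs) _ (p ∷ _) (c ∷ _) = contradiction (cnt₁ {v = v} (p , c)) λ ()
      last (suc m) vs d ps cs = +-monoʳ-≤ (esym k (suc m) (map w es)) (*-monoʳ-≤ (w e ^ k)
        (sum-subproduct-≤ k m w es vs d (All.zipWith (λ {v} pc → suc-injective (cnt₁ {v = v} pc)) (ps , cs))))

  -- All ordered pairs, to match the double sums; the restriction to a < b is left to `edge?` and to
  -- the masses.
  pairs : ∀ N → List (Fin N × Fin N)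
  pairs N = cartesianProduct (allFin N) (allFin N)

  ∈-pairs : ∀ {N} (a b : Fin N) → (a , b) ∈ pairs N
  ∈-pairs a b = ∈-cartesianProduct⁺ (∈-allFin a) (∈-allFin b)

  sum-cartesianProduct : ∀ {A B : Set} (h : A × B → ℕ) xs ys →
    sum (map h (cartesianProduct xs ys)) ≡ sum (map (λ x → sum (map (λ y → h (x , y)) ys)) xs)
  sum-cartesianProduct h []       ys = refl
  sum-cartesianProduct h (x ∷ xs) ys
    = trans (cong sum (map-++ h (map (x ,_) ys) (cartesianProduct xs ys)))
     (trans (sum-++ (map h (map (x ,_) ys)) (map h (cartesianProduct xs ys)))
        (cong₂ _+_ (cong sum (sym (map-∘ ys))) (sum-cartesianProduct h xs ys)))

  product-cartesianProduct : ∀ {A B : Set} (h : A × B → ℕ) xs ys →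
    product (map h (cartesianProduct xs ys)) ≡ product (map (λ x → product (map (λ y → h (x , y)) ys)) xs)
  product-cartesianProduct h []       ys = refl
  product-cartesianProduct h (x ∷ xs) ys
    = trans (cong product (map-++ h (map (x ,_) ys) (cartesianProduct xs ys)))
     (trans (product-++ (map h (map (x ,_) ys)) (map h (cartesianProduct xs ys)))
        (cong₂ _*_ (cong product (sym (map-∘ ys))) (product-cartesianProduct h xs ys)))

  map-allFin-suc : ∀ {A : Set} N (f : Fin (suc N) → A) →
    map f (allFin (suc N)) ≡ f Fin.zero ∷ map (λ i → f (Fin.suc i)) (allFin N)
  map-allFin-suc N f = cong (f Fin.zero ∷_)
    (trans (map-tabulate Fin.suc f) (sym (map-tabulate (λ i → i) (λ i → f (Fin.suc i)))))

  sumℕ-allFin : ∀ N (f : Fin N → ℕ) → sumℕ N f ≡ sum (map f (allFin N))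
  sumℕ-allFin zero    f = refl
  sumℕ-allFin (suc N) f = trans (cong (f Fin.zero +_) (sumℕ-allFin N _)) (cong sum (sym (map-allFin-suc N f)))

  sumℕ-cong : ∀ N {f g : Fin N → ℕ} → (∀ i → f i ≡ g i) → sumℕ N f ≡ sumℕ N g
  sumℕ-cong zero    eq = refl
  sumℕ-cong (suc N) eq = cong₂ _+_ (eq Fin.zero) (sumℕ-cong N (λ i → eq (Fin.suc i)))

  sumℕ-+ : ∀ N (f g : Fin N → ℕ) → sumℕ N (λ i → f i + g i) ≡ sumℕ N f + sumℕ N g
  sumℕ-+ zero    f g = refl
  sumℕ-+ (suc N) f g rewrite sumℕ-+ N (λ i → f (Fin.suc i)) (λ i → g (Fin.suc i)) = ring (f Fin.zero) (g Fin.zero) _ _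
    where
    ring : ∀ a b c d → a + b + (c + d) ≡ a + c + (b + d)
    ring = solve-∀

  sumℕ-0 : ∀ N → sumℕ N (λ _ → 0) ≡ 0
  sumℕ-0 zero    = refl
  sumℕ-0 (suc N) = sumℕ-0 N

  sumℕ-swap : ∀ M N (h : Fin M → Fin N → ℕ) →
    sumℕ M (λ i → sumℕ N (λ j → h i j)) ≡ sumℕ N (λ j → sumℕ M (λ i → h i j))
  sumℕ-swap zero    N h = sym (sumℕ-0 N)
  sumℕ-swap (suc M) N h rewrite sumℕ-swap M N (λ i → h (Fin.suc i)) = sym (sumℕ-+ N _ _)

  sumℕ-pairs : ∀ N (h : Fin N × Fin N → ℕ) → sumℕ N (λ a → sumℕ N (λ b → h (a , b))) ≡ sum (map h (pairs N))
  sumℕ-pairs N h = begin-equality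
    sumℕ N (λ a → sumℕ N (λ b → h (a , b)))       ≡⟨ sumℕ-cong N (λ a → sumℕ-allFin N _) ⟩
    sumℕ N (λ a → sum (map (λ b → h (a , b)) (allFin N))) ≡⟨ sumℕ-allFin N _ ⟩
    sum (map (λ a → sum (map (λ b → h (a , b)) (allFin N))) (allFin N)) ≡⟨ sum-cartesianProduct h (allFin N) (allFin N) ⟨
    sum (map h (pairs N))                         ∎

  edge? : ∀ {N} → Graph N → Fin N × Fin N → Bool
  edge? G (a , b) = adj G a b ∧ (toℕ a <ᵇ toℕ b)

  edgeCount-pairs : ∀ {N} (G : Graph N) → edgeCount G ≡ count (edge? G) (pairs N)
  edgeCount-pairs {N} G = sumℕ-pairs N _

  -- Every edge appears in both directions: the vertex map of a copy need not preserve the order of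
  -- vertices, so it carries arcs to arcs but not increasing pairs to increasing pairs.
  arcs : ∀ {N} → Graph N → List (Fin N × Fin N)
  arcs {N} G = filter (λ e → uncurry (adj G) e Bool.≟ true) (pairs N)

  length-filter-≟true : ∀ {A : Set} (v : A → Bool) xs →
    length (filter (λ x → v x Bool.≟ true) xs) ≡ count v xs
  length-filter-≟true v []       = refl
  length-filter-≟true v (x ∷ xs) with v x
  ... | true  = cong suc (length-filter-≟true v xs)
  ... | false = length-filter-≟true v xs

  <ᵇ-true : ∀ {m n} → m < n → (m <ᵇ n) ≡ true
  <ᵇ-true {m} {n} m<n with m <ᵇ n | <⇒<ᵇ m<n
  ... | true | _ = refl

  <ᵇ-false : ∀ {m n} → ¬ m < n → (m <ᵇ n) ≡ false
  <ᵇ-false {m} {n} m≮n with m <ᵇ n in eq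
  ... | false = refl
  ... | true  = contradiction (<ᵇ⇒< m n (subst T (sym eq) _)) m≮n

  length-arcs : ∀ {N} (G : Graph N) → IsSimple G → length (arcs G) ≡ edgeCount G + edgeCount G
  length-arcs {N} G (symmetric , loopless) = begin-equality
    length (arcs G)                                       ≡⟨ length-filter-≟true (uncurry (adj G)) (pairs N) ⟩
    count (uncurry (adj G)) (pairs N)                     ≡⟨ sumℕ-pairs N _ ⟨
    ∑ (λ a b → if adj G a b then 1 else 0)                ≡⟨ sumℕ-cong N (λ a → sumℕ-cong N (orient a)) ⟩
    ∑ (λ a b → up a b + up b a)                           ≡⟨ sumℕ-cong N (λ a → sumℕ-+ N _ _) ⟩
    sumℕ N (λ a → sumℕ N (λ b → up a b) + sumℕ N (λ b → up b a)) ≡⟨ sumℕ-+ N _ _ ⟩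
    edgeCount G + ∑ (λ a b → up b a)                      ≡⟨ cong (edgeCount G +_) (sumℕ-swap N N (λ a b → up b a)) ⟩
    edgeCount G + edgeCount G                             ∎
    where
    ∑ : (Fin N → Fin N → ℕ) → ℕ
    ∑ h = sumℕ N (λ a → sumℕ N (λ b → h a b))
    up : Fin N → Fin N → ℕ
    up a b = if edge? G (a , b) then 1 else 0
    orient : ∀ a b → (if adj G a b then 1 else 0) ≡ up a b + up b a
    orient a b with <-cmp (toℕ a) (toℕ b)
    ... | tri< a<b _ b≮a rewrite <ᵇ-true a<b | <ᵇ-false b≮a | symmetric b a with adj G a b
    ...   | true  = refl
    ...   | false = refl
    orient a b | tri> a≮b _ b<a rewrite <ᵇ-true b<a | <ᵇ-false a≮b | symmetric b a with adj G a b
    ...   | true  = refl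
    ...   | false = refl
    orient a b | tri≈ _ a≡b _ rewrite toℕ-injective a≡b | loopless b = refl

  bool-ext : ∀ {x y} → (x ≡ true → y ≡ true) → (y ≡ true → x ≡ true) → x ≡ y
  bool-ext {true}  {y}     f g = sym (f refl)
  bool-ext {false} {false} f g = refl
  bool-ext {false} {true}  f g = g refl

  -- A `Graph N` may be any Boolean matrix. By injectivity of the vertex map, a loop of a copy would
  -- come from a loop of `H`.
  copy-simple : ∀ {n N} (H : Graph n) (G : Graph N) → IsSimple H → IsCopy H G → IsSimple G
  copy-simple H G (symmetric , loopless) (f , f-inj , spec) =
    (λ a b → bool-ext (flip a b) (flip b a)) ,
    (λ a → bool-ext (λ p → loop a (proj₁ (spec a a) p)) λ ())
    where
    flip : ∀ a b → adj G a b ≡ true → adj G b a ≡ true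
    flip a b p with i , j , fi , fj , q ← proj₁ (spec a b) p =
      proj₂ (spec b a) (j , i , fj , fi , trans (symmetric j i) q)
    loop : ∀ a → Σ _ (λ i → Σ _ λ j → f i ≡ a × f j ≡ a × adj H i j ≡ true) → false ≡ true
    loop a (i , j , fi , fj , q) with refl ← f-inj i j (trans fi (sym fj)) = trans (sym (loopless i)) q

  -- The vertex map induces a bijection of arcs, and duplicate-free lists with the same members have
  -- the same length; halving gives the edges.
  copy-edgeCount : ∀ {n N} (H : Graph n) (G : Graph N) → IsSimple H → IsCopy H G → edgeCount G ≡ edgeCount H
  copy-edgeCount {n} {N} H G simple copy@(f , f-inj , spec) = *-cancelˡ-≡ _ _ 2 (begin-equality
    2 * edgeCount G                ≡⟨ cong (edgeCount G +_) (+-identityʳ _) ⟩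
    edgeCount G + edgeCount G      ≡⟨ length-arcs G (copy-simple H G simple copy) ⟨
    length (arcs G)                ≡⟨ ↭-length (∼bag⇒↭ (unique∧set⇒bag (unique-arcs G)
                                        (Uniqueₚ.map⁺ f²-inj (unique-arcs H)) (mk⇔ to from))) ⟩
    length (map f² (arcs H))       ≡⟨ length-map f² (arcs H) ⟩
    length (arcs H)                ≡⟨ length-arcs H simple ⟩
    edgeCount H + edgeCount H      ≡⟨ cong (edgeCount H +_) (+-identityʳ _) ⟨
    2 * edgeCount H                ∎)
    where
    f² : Fin n × Fin n → Fin N × Fin N
    f² (i , j) = f i , f j
    f²-inj : ∀ {p q} → f² p ≡ f² q → p ≡ q
    f²-inj eq with p , q ← ,-injective eq = cong₂ _,_ (f-inj _ _ p) (f-inj _ _ q)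
    unique-arcs : ∀ {M} (K : Graph M) → Unique (arcs K)
    unique-arcs {M} K = Uniqueₚ.filter⁺ _ (Uniqueₚ.cartesianProduct⁺ (Uniqueₚ.allFin⁺ M) (Uniqueₚ.allFin⁺ M))
    to : ∀ {e} → e ∈ arcs G → e ∈ map f² (arcs H)
    to {a , b} e∈ with i , j , refl , refl , q ← proj₁ (spec a b) (proj₂ (∈-filter⁻ (λ e → uncurry (adj G) e Bool.≟ true) {xs = pairs N} e∈)) =
      ∈-map⁺ f² (∈-filter⁺ _ (∈-pairs i j) q)
    from : ∀ {e} → e ∈ map f² (arcs H) → e ∈ arcs G
    from e∈ with (i , j) , ij∈ , refl ← ∈-map⁻ f² e∈ =
      ∈-filter⁺ _ (∈-pairs (f i) (f j)) (proj₂ (spec (f i) (f j))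
        (i , j , refl , refl , proj₂ (∈-filter⁻ (λ e → uncurry (adj H) e Bool.≟ true) {xs = pairs n} ij∈)))

  graph-ext : ∀ {N} {G G′ : Graph N} → (∀ a b → adj G a b ≡ adj G′ a b) → G ≡ G′
  graph-ext {G = G} {G′} eq = vec-ext (λ a → vec-ext (eq a))
    where
    vec-ext : ∀ {A : Set} {n} {u v : Vec A n} → (∀ i → lookup u i ≡ lookup v i) → u ≡ v
    vec-ext {u = u} {v} p = trans (sym (tabulate∘lookup u)) (trans (tabulate-cong p) (tabulate∘lookup v))

  map-≡⇒∈-≡ : ∀ {A B : Set} {f g : A → B} {xs x} → map f xs ≡ map g xs → x ∈ xs → f x ≡ g x
  map-≡⇒∈-≡ {xs = _ ∷ _} eq (here refl) = ∷-injectiveˡ eq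
  map-≡⇒∈-≡ {xs = _ ∷ _} eq (there x∈)    = map-≡⇒∈-≡ (∷-injectiveʳ eq) x∈

  -- A symmetric matrix with empty diagonal is determined by the part above the diagonal, which is
  -- all that `edge?` sees.
  simple-edge?-injective : ∀ {N} (G G′ : Graph N) → IsSimple G → IsSimple G′ →
    map (edge? G) (pairs N) ≡ map (edge? G′) (pairs N) → G ≡ G′
  simple-edge?-injective G G′ (sym₁ , loop₁) (sym₂ , loop₂) eq = graph-ext same
    where
    oriented : ∀ a b → toℕ a < toℕ b → adj G a b ≡ adj G′ a b
    oriented a b a<b with map-≡⇒∈-≡ eq (∈-pairs a b)
    ... | p rewrite <ᵇ-true a<b = trans (sym (∧-identityʳ _)) (trans p (∧-identityʳ _))
    same : ∀ a b → adj G a b ≡ adj G′ a b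
    same a b with <-cmp (toℕ a) (toℕ b)
    ... | tri< a<b _ _ = oriented a b a<b
    ... | tri> _ _ b<a = trans (sym₁ a b) (trans (oriented b a b<a) (sym₂ b a))
    ... | tri≈ _ a≡b _ with refl ← toℕ-injective a≡b = trans (loop₁ a) (sym (loop₂ a))

  sum-copies-≤ : ∀ {n N} (H : Graph n) (k : ℕ) (w : Fin N × Fin N → ℕ) (L : List (Graph N)) →
    IsSimple H → Unique L → All (IsCopy H) L →
    sum (map (λ G → subproduct w (edge? G) (pairs N) ^ k) L) ≤ esym k (edgeCount H) (map w (pairs N))
  sum-copies-≤ {N = N} H k w L simple unique copies = begin
    sum (map (λ G → subproduct w (edge? G) (pairs N) ^ k) L)       ≡⟨ cong sum (map-∘ L) ⟩
    sum (map (λ v → subproduct w v (pairs N) ^ k) (map edge? L))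
      ≤⟨ sum-subproduct-≤ k (edgeCount H) w (pairs N) (map edge? L)
           (AllPairsₚ.map⁺ (distinct copies unique))
           (Allₚ.map⁺ (All.map (λ {G} c → trans (sym (edgeCount-pairs G)) (copy-edgeCount H G simple c)) copies)) ⟩
    esym k (edgeCount H) (map w (pairs N)) ∎
    where
    distinct : ∀ {L} → All (IsCopy H) L → Unique L → AllPairs (λ G G′ → DifferOn (pairs N) (edge? G) (edge? G′)) L
    distinct []       []       = []
    distinct (_∷_ {x = G} c cs) (u ∷ us) = All.zipWith (λ { {G′} (c′ , G≢) eq →
      G≢ (simple-edge?-injective G G′ (copy-simple H G simple c) (copy-simple H G′ simple c′) eq) }) (cs , u) ∷ distinct cs us

-- From natural numbers to rational masses

module Bound where

  open PowerSums
  open Counting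
  open import Data.Nat as ℕ using (ℕ; zero; suc)
  import Data.Nat.Properties as ℕ
  import Data.Nat.Divisibility as ℕ
  import Data.Nat.DivMod as ℕ
  open import Data.Nat.ListAction using (sum; product)
  open import Data.Nat.ListAction.Properties using (∈⇒∣product; product≢0)
  open import Data.Integer as ℤ using (-[1+_])
  import Data.Integer.Properties as ℤ
  open import Data.Rational
  open import Data.Rational.Properties
  open import Data.Rational.Unnormalised as ℚᵘ using (mkℚᵘ; *≡*)
  import Data.Rational.Unnormalised.Properties as ℚᵘ
  open import Data.Bool using (Bool; true; false; if_then_else_; T)
  open import Data.Fin as Fin using (Fin; toℕ)
  open import Data.List using (List; []; _∷_; map; allFin)
  open import Data.List.Relation.Unary.All using (All; []; _∷_)
  import Data.List.Relation.Unary.All as All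
  import Data.List.Relation.Unary.All.Properties as Allₚ
  open import Data.List.Membership.Propositional using (_∈_)
  open import Data.List.Membership.Propositional.Properties using (∈-map⁺)
  open import Data.List.Relation.Unary.Any using (here; there)
  open import Data.Product using (∃₂; _×_; _,_; proj₁; proj₂)
  open import Relation.Binary.PropositionalEquality
  open import Algebra.Bundles using (CommutativeMonoid)
  open import Algebra.Properties.CommutativeSemigroup
    (CommutativeMonoid.commutativeSemigroup *-1-commutativeMonoid)
    using (interchange)

  -- Recursion makes additivity an induction without normalising fractions; `toℚᵘ-ι` recovers the
  -- fraction n / 1.
  ι : ℕ → ℚ
  ι zero    = 0ℚ
  ι (suc n) = 1ℚ + ι n

  ι-+ : ∀ a b → ι (a ℕ.+ b) ≡ ι a + ι b
  ι-+ zero    b = sym (+-identityˡ (ι b))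
  ι-+ (suc a) b = trans (cong (1ℚ +_) (ι-+ a b)) (sym (+-assoc 1ℚ (ι a) (ι b)))

  ι-* : ∀ a b → ι (a ℕ.* b) ≡ ι a * ι b
  ι-* zero    b = sym (*-zeroˡ (ι b))
  ι-* (suc a) b = begin
    ι (b ℕ.+ a ℕ.* b)       ≡⟨ ι-+ b (a ℕ.* b) ⟩
    ι b + ι (a ℕ.* b)       ≡⟨ cong₂ _+_ (sym (*-identityˡ (ι b))) (ι-* a b) ⟩
    1ℚ * ι b + ι a * ι b    ≡⟨ *-distribʳ-+ (ι b) 1ℚ (ι a) ⟨
    (1ℚ + ι a) * ι b        ∎
    where open ≡-Reasoning

  ι-^ : ∀ a k → ι (a ℕ.^ k) ≡ powℚ (ι a) k
  ι-^ a zero    = +-identityʳ 1ℚ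
  ι-^ a (suc k) = trans (ι-* a (a ℕ.^ k)) (cong (ι a *_) (ι-^ a k))

  ι-nonNeg : ∀ a → NonNegative (ι a)
  ι-nonNeg zero    = _
  ι-nonNeg (suc a) = nonNeg+nonNeg⇒nonNeg 1ℚ (ι a) {{ι-nonNeg a}}

  ι-pos : ∀ a .{{_ : ℕ.NonZero a}} → Positive (ι a)
  ι-pos (suc a) = pos+nonNeg⇒pos 1ℚ (ι a) {{ι-nonNeg a}}

  ι-mono-≤ : ∀ {a b} → a ℕ.≤ b → ι a ≤ ι b
  ι-mono-≤ {a} {b} a≤b = begin
    ι a                   ≡⟨ +-identityʳ (ι a) ⟨
    ι a + 0ℚ              ≤⟨ +-monoʳ-≤ (ι a) (nonNegative⁻¹ (ι (b ℕ.∸ a)) {{ι-nonNeg (b ℕ.∸ a)}}) ⟩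
    ι a + ι (b ℕ.∸ a)     ≡⟨ ι-+ a (b ℕ.∸ a) ⟨
    ι (a ℕ.+ (b ℕ.∸ a))   ≡⟨ cong ι (ℕ.m+[n∸m]≡n a≤b) ⟩
    ι b                   ∎
    where open ≤-Reasoning

  toℚᵘ-ι : ∀ n → toℚᵘ (ι n) ℚᵘ.≃ mkℚᵘ (ℤ.+ n) 0
  toℚᵘ-ι zero    = *≡* refl
  toℚᵘ-ι (suc n) = begin
    toℚᵘ (1ℚ + ι n)               ≈⟨ toℚᵘ-homo-+ 1ℚ (ι n) ⟩
    toℚᵘ 1ℚ ℚᵘ.+ toℚᵘ (ι n)       ≈⟨ ℚᵘ.+-congʳ (toℚᵘ 1ℚ) (toℚᵘ-ι n) ⟩
    toℚᵘ 1ℚ ℚᵘ.+ mkℚᵘ (ℤ.+ n) 0     ≈⟨ *≡* (cong (λ z → z ℤ.* ℤ.+ 1) (cong (λ z → ℤ.+ 1 ℤ.+ z) (ℤ.*-identityʳ (ℤ.+ n)))) ⟩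
    mkℚᵘ (ℤ.+ suc n) 0              ∎
    where open import Relation.Binary.Reasoning.Setoid ℚᵘ.≃-setoid

  fraction-* : ∀ n d → (ℤ.+ n / suc d) * ι (suc d) ≡ ι n
  fraction-* n d = toℚᵘ-injective (begin
    toℚᵘ ((ℤ.+ n / suc d) * ι (suc d))          ≈⟨ toℚᵘ-homo-* (ℤ.+ n / suc d) (ι (suc d)) ⟩
    toℚᵘ (ℤ.+ n / suc d) ℚᵘ.* toℚᵘ (ι (suc d))  ≈⟨ ℚᵘ.*-cong (toℚᵘ-fromℚᵘ (mkℚᵘ (ℤ.+ n) d)) (toℚᵘ-ι (suc d)) ⟩
    mkℚᵘ (ℤ.+ n) d ℚᵘ.* mkℚᵘ (ℤ.+ suc d) 0        ≈⟨ *≡* (trans (ℤ.*-identityʳ _) (cong (λ z → ℤ.+ n ℤ.* z) (cong (λ z → ℤ.+ suc z) (sym (ℕ.*-identityʳ d))))) ⟩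
    mkℚᵘ (ℤ.+ n) 0                              ≈⟨ toℚᵘ-ι n ⟨
    toℚᵘ (ι n)                                ∎)
    where open import Relation.Binary.Reasoning.Setoid ℚᵘ.≃-setoid

  nonNeg-numerator : ∀ q → 0ℚ ≤ q → q * ι (↧ₙ q) ≡ ι ℤ.∣ ↥ q ∣
  nonNeg-numerator (mkℚ (ℤ.+ n) d c) _ =
    trans (cong (_* ι (suc d)) (sym (fromℚᵘ-toℚᵘ (mkℚ (ℤ.+ n) d c)))) (fraction-* n d)
  nonNeg-numerator (mkℚ -[1+ n ] d c) (*≤* ())

  common-denominator : ∀ {A : Set} (es : List A) (g : A → ℚ) → (∀ e → 0ℚ ≤ g e) →
    ∃₂ λ D (w : A → ℕ) → ℕ.NonZero D × ∀ {e} → e ∈ es → g e * ι D ≡ ι (w e)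
  common-denominator {A} es g g≥0 = D , w , product≢0 (Allₚ.map⁺ (All.universal (λ _ → _) es)) , clear
    where
    D = product (map (λ e → ↧ₙ (g e)) es)
    w : A → ℕ
    -- For `e` in `es` the denominator divides `D`, so the truncated division is exact.
    w e = ℤ.∣ ↥ g e ∣ ℕ.* (D ℕ./ ↧ₙ (g e))
    open ≡-Reasoning
    clear : ∀ {e} → e ∈ es → g e * ι D ≡ ι (w e)
    clear {e} e∈ = begin
      g e * ι D                                        ≡⟨ cong (λ z → g e * ι z) (ℕ.m*[n/m]≡n (∈⇒∣product (∈-map⁺ _ e∈))) ⟨
      g e * ι (↧ₙ (g e) ℕ.* (D ℕ./ ↧ₙ (g e)))          ≡⟨ cong (g e *_) (ι-* (↧ₙ (g e)) (D ℕ./ ↧ₙ (g e))) ⟩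
      g e * (ι (↧ₙ (g e)) * ι (D ℕ./ ↧ₙ (g e)))        ≡⟨ *-assoc (g e) _ _ ⟨
      g e * ι (↧ₙ (g e)) * ι (D ℕ./ ↧ₙ (g e))          ≡⟨ cong (_* ι (D ℕ./ ↧ₙ (g e))) (nonNeg-numerator (g e) (g≥0 e)) ⟩
      ι ℤ.∣ ↥ g e ∣ * ι (D ℕ./ ↧ₙ (g e))               ≡⟨ ι-* ℤ.∣ ↥ g e ∣ _ ⟨
      ι (w e)                                          ∎

  powℚ-+ : ∀ q a b → powℚ q (a ℕ.+ b) ≡ powℚ q a * powℚ q b
  powℚ-+ q zero    b = sym (*-identityˡ _)
  powℚ-+ q (suc a) b = trans (cong (q *_) (powℚ-+ q a b)) (sym (*-assoc q _ _))

  powℚ-* : ∀ p q k → powℚ (p * q) k ≡ powℚ p k * powℚ q k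
  powℚ-* p q zero    = sym (*-identityˡ 1ℚ)
  powℚ-* p q (suc k) = trans (cong (p * q *_) (powℚ-* p q k)) (interchange p q (powℚ p k) (powℚ q k))

  powℚ-powℚ : ∀ q m k → powℚ (powℚ q m) k ≡ powℚ q (k ℕ.* m)
  powℚ-powℚ q m zero    = refl
  powℚ-powℚ q m (suc k) = trans (cong (powℚ q m *_) (powℚ-powℚ q m k)) (sym (powℚ-+ q m (k ℕ.* m)))

  powℚ-1 : ∀ k → powℚ 1ℚ k ≡ 1ℚ
  powℚ-1 zero    = refl
  powℚ-1 (suc k) = trans (*-identityˡ _) (powℚ-1 k)

  powℚ-nonNeg : ∀ q k → 0ℚ ≤ q → 0ℚ ≤ powℚ q k
  powℚ-nonNeg q zero    0≤q = nonNegative⁻¹ 1ℚ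
  powℚ-nonNeg q (suc k) 0≤q = nonNegative⁻¹ _
    {{nonNeg*nonNeg⇒nonNeg q {{nonNegative 0≤q}} _ {{nonNegative (powℚ-nonNeg q k 0≤q)}}}}

  sumℚ-clear : ∀ N d (f : Fin N → ℚ) (g : Fin N → ℕ) → (∀ i → f i * d ≡ ι (g i)) → sumℚ N f * d ≡ ι (sumℕ N g)
  sumℚ-clear zero    d f g eq = *-zeroˡ d
  sumℚ-clear (suc N) d f g eq = begin
    (f Fin.zero + sumℚ N _) * d        ≡⟨ *-distribʳ-+ d (f Fin.zero) _ ⟩
    f Fin.zero * d + sumℚ N _ * d      ≡⟨ cong₂ _+_ (eq Fin.zero) (sumℚ-clear N d _ _ (λ i → eq (Fin.suc i))) ⟩
    ι (g Fin.zero) + ι (sumℕ N _)      ≡⟨ ι-+ (g Fin.zero) _ ⟨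
    ι (sumℕ (suc N) g)                 ∎
    where open ≡-Reasoning

  -- The exponent depends on the factor because only an edge carries a denominator: a non-edge
  -- contributes 1 with exponent 0, so the exponents add up to the number of edges.
  prodℚ-clear : ∀ N d (f : Fin N → ℚ) (e g : Fin N → ℕ) → (∀ i → f i * powℚ d (e i) ≡ ι (g i)) →
    prodℚ N f * powℚ d (sumℕ N e) ≡ ι (product (map g (allFin N)))
  prodℚ-clear zero    d f e g eq = trans (*-identityˡ 1ℚ) (sym (+-identityʳ 1ℚ))
  prodℚ-clear (suc N) d f e g eq = begin
    f Fin.zero * prodℚ N _ * powℚ d (e Fin.zero ℕ.+ sumℕ N _)           ≡⟨ cong (f Fin.zero * prodℚ N _ *_) (powℚ-+ d (e Fin.zero) _) ⟩
    f Fin.zero * prodℚ N _ * (powℚ d (e Fin.zero) * powℚ d (sumℕ N _))  ≡⟨ interchange (f Fin.zero) _ _ _ ⟩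
    f Fin.zero * powℚ d (e Fin.zero) * (prodℚ N _ * powℚ d (sumℕ N _))  ≡⟨ cong₂ _*_ (eq Fin.zero) (prodℚ-clear N d _ _ _ (λ i → eq (Fin.suc i))) ⟩
    ι (g Fin.zero) * ι (product (map (λ i → g (Fin.suc i)) (allFin N))) ≡⟨ ι-* (g Fin.zero) _ ⟨
    ι (g Fin.zero ℕ.* product (map (λ i → g (Fin.suc i)) (allFin N)))   ≡⟨ cong (λ z → ι (product z)) (map-allFin-suc N g) ⟨
    ι (product (map g (allFin (suc N))))                                ∎
    where open ≡-Reasoning

  sumℚ-ι-* : ∀ N q (f : Fin N → ℚ) (e : Fin N → ℕ) → (∀ i → f i ≡ ι (e i) * q) → sumℚ N f ≡ ι (sumℕ N e) * q
  sumℚ-ι-* zero    q f e eq = sym (*-zeroˡ q)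
  sumℚ-ι-* (suc N) q f e eq = begin
    f Fin.zero + sumℚ N _                  ≡⟨ cong₂ _+_ (eq Fin.zero) (sumℚ-ι-* N q _ _ (λ i → eq (Fin.suc i))) ⟩
    ι (e Fin.zero) * q + ι (sumℕ N _) * q  ≡⟨ *-distribʳ-+ q (ι (e Fin.zero)) _ ⟨
    (ι (e Fin.zero) + ι (sumℕ N _)) * q    ≡⟨ cong (_* q) (ι-+ (e Fin.zero) _) ⟨
    ι (sumℕ (suc N) e) * q                 ∎
    where open ≡-Reasoning

  prodℚ-powℚ : ∀ N q (f : Fin N → ℚ) (e : Fin N → ℕ) → (∀ i → f i ≡ powℚ q (e i)) → prodℚ N f ≡ powℚ q (sumℕ N e)
  prodℚ-powℚ zero    q f e eq = refl
  prodℚ-powℚ (suc N) q f e eq =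
    trans (cong₂ _*_ (eq Fin.zero) (prodℚ-powℚ N q _ _ (λ i → eq (Fin.suc i)))) (sym (powℚ-+ q (e Fin.zero) _))

  prodℚ-nonNeg : ∀ N (f : Fin N → ℚ) → (∀ i → 0ℚ ≤ f i) → 0ℚ ≤ prodℚ N f
  prodℚ-nonNeg zero    f f≥0 = nonNegative⁻¹ 1ℚ
  prodℚ-nonNeg (suc N) f f≥0 = nonNegative⁻¹ _
    {{nonNeg*nonNeg⇒nonNeg (f Fin.zero) {{nonNegative (f≥0 Fin.zero)}} _
      {{nonNegative (prodℚ-nonNeg N _ (λ i → f≥0 (Fin.suc i)))}}}}

  weight-nonNeg : ∀ {N} (μ : Fin N → Fin N → ℚ) (G : Graph N) →
    (∀ a b → toℕ a ℕ.< toℕ b → 0ℚ ≤ μ a b) → 0ℚ ≤ weight μ G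
  weight-nonNeg {N} μ G μ≥0 = prodℚ-nonNeg N _ (λ a → prodℚ-nonNeg N _ (factor a))
    where
    factor : ∀ a b → 0ℚ ≤ (if edge? G (a , b) then μ a b else 1ℚ)
    factor a b with adj G a b
    ... | false = nonNegative⁻¹ 1ℚ
    ... | true with toℕ a ℕ.<ᵇ toℕ b in a<b
    ...   | false = nonNegative⁻¹ 1ℚ
    ...   | true  = μ≥0 a b (ℕ.<ᵇ⇒< _ _ (subst T (sym a<b) _))

  betaList-∈ : ∀ {N} (μ : Fin N → Fin N → ℚ) k {L : List (Graph N)} {G} →
    (∀ G → 0ℚ ≤ weight μ G) → G ∈ L → powℚ (weight μ G) k ≤ betaList μ k L
  betaList-∈ {N} μ k w≥0 = go
    where
    open ≤-Reasoning
    betaList-nonNeg : ∀ L → 0ℚ ≤ betaList μ k L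
    betaList-nonNeg []      = ≤-refl
    betaList-nonNeg (G ∷ L) = +-mono-≤ (powℚ-nonNeg _ k (w≥0 G)) (betaList-nonNeg L)
    go : ∀ {L G} → G ∈ L → powℚ (weight μ G) k ≤ betaList μ k L
    go {L = G ∷ L} (here refl) = begin
      powℚ (weight μ G) k         ≡⟨ +-identityʳ _ ⟨
      powℚ (weight μ G) k + 0ℚ    ≤⟨ +-monoʳ-≤ (powℚ (weight μ G) k) (betaList-nonNeg L) ⟩
      betaList μ k (G ∷ L)        ∎
    go {L = G′ ∷ L} {G} (there G∈) = begin
      powℚ (weight μ G) k         ≡⟨ +-identityˡ _ ⟨
      0ℚ + powℚ (weight μ G) k    ≤⟨ +-mono-≤ (powℚ-nonNeg _ k (w≥0 G′)) (go G∈) ⟩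
      betaList μ k (G′ ∷ L)       ∎

  invPow-clear : ∀ m e .{{_ : ℕ.NonZero m}} → invPow m e * ι (m ℕ.^ e) ≡ 1ℚ
  invPow-clear (suc m) e = begin
    powℚ (ℤ.+ 1 / suc m) e * ι (suc m ℕ.^ e)      ≡⟨ cong (powℚ (ℤ.+ 1 / suc m) e *_) (ι-^ (suc m) e) ⟩
    powℚ (ℤ.+ 1 / suc m) e * powℚ (ι (suc m)) e   ≡⟨ powℚ-* (ℤ.+ 1 / suc m) (ι (suc m)) e ⟨
    powℚ ((ℤ.+ 1 / suc m) * ι (suc m)) e          ≡⟨ cong (λ z → powℚ z e) (trans (fraction-* 1 m) (+-identityʳ 1ℚ)) ⟩
    powℚ 1ℚ e                                   ≡⟨ powℚ-1 e ⟩
    1ℚ                                          ∎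
    where open ≡-Reasoning

  -- The upper bound

  module _ {N : ℕ} (μ : Fin N → Fin N → ℚ) (mass : IsProbMass μ) where

    private
      -- Extending μ by 0 makes it nonnegative on all of Fin N × Fin N.
      μ⁰ : Fin N × Fin N → ℚ
      μ⁰ (a , b) = if toℕ a ℕ.<ᵇ toℕ b then μ a b else 0ℚ

      μ⁰-nonNeg : ∀ e → 0ℚ ≤ μ⁰ e
      μ⁰-nonNeg (a , b) with toℕ a ℕ.<ᵇ toℕ b in a<b
      ... | false = ≤-refl
      ... | true  = proj₁ mass a b (ℕ.<ᵇ⇒< _ _ (subst T (sym a<b) _))

      clearing = common-denominator (pairs N) μ⁰ μ⁰-nonNeg
      D = proj₁ clearing
      w = proj₁ (proj₂ clearing)
      D≢0 : ℕ.NonZero D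
      D≢0 = proj₁ (proj₂ (proj₂ clearing))
      μ⁰-clear : ∀ a b → μ⁰ (a , b) * ι D ≡ ι (w (a , b))
      μ⁰-clear a b = proj₂ (proj₂ (proj₂ clearing)) (∈-pairs a b)

    -- The masses sum to 1, so the common denominator is the sum of the integer weights, and its
    -- power is the right side of `esym-bound`.
    total-clear : ι D ≡ ι (sum (map w (pairs N)))
    total-clear = begin
      ι D                                                ≡⟨ *-identityˡ (ι D) ⟨
      1ℚ * ι D                                           ≡⟨ cong (_* ι D) (proj₂ mass) ⟨
      sumℚ N (λ a → sumℚ N (λ b → μ⁰ (a , b))) * ι D     ≡⟨ sumℚ-clear N (ι D) _ _ (λ a → sumℚ-clear N (ι D) _ _ (μ⁰-clear a)) ⟩
      ι (sumℕ N (λ a → sumℕ N (λ b → w (a , b))))        ≡⟨ cong ι (sumℕ-pairs N w) ⟩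
      ι (sum (map w (pairs N)))                          ∎
      where open ≡-Reasoning

    weight-clear : ∀ G → weight μ G * powℚ (ι D) (edgeCount G) ≡ ι (subproduct w (edge? G) (pairs N))
    weight-clear G = trans
      (prodℚ-clear N (ι D) _ _ _ (λ a → prodℚ-clear N (ι D) _ _ _ (factor a)))
      (cong ι (sym (product-cartesianProduct (λ e → if edge? G e then w e else 1) (allFin N) (allFin N))))
      where
      factor : ∀ a b → (if edge? G (a , b) then μ a b else 1ℚ) * powℚ (ι D) (if edge? G (a , b) then 1 else 0)
                     ≡ ι (if edge? G (a , b) then w (a , b) else 1)
      factor a b with adj G a b | toℕ a ℕ.<ᵇ toℕ b | μ⁰-clear a b
      ... | false | _     | _  = trans (*-identityˡ 1ℚ) (sym (+-identityʳ 1ℚ))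
      ... | true  | false | _  = trans (*-identityˡ 1ℚ) (sym (+-identityʳ 1ℚ))
      ... | true  | true  | eq = trans (cong (μ a b *_) (*-identityʳ (ι D))) eq

    betaList-clear : ∀ k m L → All (λ G → edgeCount G ≡ m) L →
      betaList μ k L * powℚ (ι D) (k ℕ.* m) ≡ ι (sum (map (λ G → subproduct w (edge? G) (pairs N) ℕ.^ k) L))
    betaList-clear k m []      []       = *-zeroˡ (powℚ (ι D) (k ℕ.* m))
    betaList-clear k m (G ∷ L) (c ∷ cs) = begin
      (powℚ (weight μ G) k + betaList μ k L) * d     ≡⟨ *-distribʳ-+ d (powℚ (weight μ G) k) (betaList μ k L) ⟩
      powℚ (weight μ G) k * d + betaList μ k L * d   ≡⟨ cong₂ _+_ first (betaList-clear k m L cs) ⟩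
      ι (s G) + ι (sum (map s L))                    ≡⟨ ι-+ (s G) (sum (map s L)) ⟨
      ι (s G ℕ.+ sum (map s L))                      ∎
      where
      open ≡-Reasoning
      d = powℚ (ι D) (k ℕ.* m)
      s : Graph N → ℕ
      s G = subproduct w (edge? G) (pairs N) ℕ.^ k
      first : powℚ (weight μ G) k * d ≡ ι (subproduct w (edge? G) (pairs N) ℕ.^ k)
      first = begin
        powℚ (weight μ G) k * d                                   ≡⟨ cong (powℚ (weight μ G) k *_) (powℚ-powℚ (ι D) m k) ⟨
        powℚ (weight μ G) k * powℚ (powℚ (ι D) m) k               ≡⟨ powℚ-* (weight μ G) _ k ⟨
        powℚ (weight μ G * powℚ (ι D) m) k                        ≡⟨ cong (λ z → powℚ (weight μ G * powℚ (ι D) z) k) c ⟨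
        powℚ (weight μ G * powℚ (ι D) (edgeCount G)) k            ≡⟨ cong (λ z → powℚ z k) (weight-clear G) ⟩
        powℚ (ι (subproduct w (edge? G) (pairs N))) k             ≡⟨ ι-^ _ k ⟨
        ι (subproduct w (edge? G) (pairs N) ℕ.^ k)                ∎

    betaList-≤ : ∀ {n} (H : Graph n) → IsSimple H → 1 ℕ.≤ edgeCount H → ∀ k → 1 ℕ.≤ k →
      (edgeCount H ℕ.+ 1) ℕ.* edgeCount H ℕ.^ (k ℕ.* edgeCount H) ℕ.≤ (edgeCount H ℕ.+ 1) ℕ.^ (k ℕ.* edgeCount H) →
      ∀ L → Enumerates H L → betaList μ k L ≤ invPow (edgeCount H) (k ℕ.* edgeCount H)
    betaList-≤ H simple 1≤m k 1≤k hyp L (unique , enum) =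
      -- The multiplier clears both denominators: `m ^ K` that of `invPow`, and `d` = D^K that of
      -- the masses.
      *-cancelʳ-≤-pos (ι (m ℕ.^ K) * d) {{pos*pos⇒pos (ι (m ℕ.^ K)) {{ι-pos _ {{ℕ.m^n≢0 m K}}}} d {{d-pos}}}} (begin
        betaList μ k L * (ι (m ℕ.^ K) * d)    ≡⟨ swap-front (betaList μ k L) (ι (m ℕ.^ K)) d ⟩
        ι (m ℕ.^ K) * (betaList μ k L * d)    ≡⟨ cong (ι (m ℕ.^ K) *_) (betaList-clear k m L (All.map (λ {G} → copy-edgeCount H G simple) copies)) ⟩
        ι (m ℕ.^ K) * ι β                     ≡⟨ ι-* (m ℕ.^ K) β ⟨
        ι (m ℕ.^ K ℕ.* β)                     ≤⟨ ι-mono-≤ (ℕ.*-monoʳ-≤ (m ℕ.^ K) (sum-copies-≤ H k w L simple unique copies)) ⟩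
        ι (m ℕ.^ K ℕ.* esym k m (map w (pairs N))) ≤⟨ ι-mono-≤ (esym-bound k m 1≤k 1≤m hyp (map w (pairs N))) ⟩
        ι (sum (map w (pairs N)) ℕ.^ K)       ≡⟨ ι-^ _ K ⟩
        powℚ (ι (sum (map w (pairs N)))) K    ≡⟨ cong (λ z → powℚ z K) total-clear ⟨
        d                                     ≡⟨ *-identityˡ d ⟨
        1ℚ * d                                ≡⟨ cong (_* d) (invPow-clear m K) ⟨
        invPow m K * ι (m ℕ.^ K) * d          ≡⟨ *-assoc (invPow m K) _ d ⟩
        invPow m K * (ι (m ℕ.^ K) * d)        ∎)
      where
      open ≤-Reasoning
      m = edgeCount H
      K = k ℕ.* m
      instance
        m≢0 : ℕ.NonZero m
        m≢0 = ℕ.>-nonZero 1≤m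
      d = powℚ (ι D) K
      β = sum (map (λ G → subproduct w (edge? G) (pairs N) ℕ.^ k) L)
      copies : All (IsCopy H) L
      copies = All.tabulate (λ {G} → proj₁ (enum G))
      d-pos : Positive d
      d-pos = subst Positive (ι-^ D K) (ι-pos (D ℕ.^ K) {{ℕ.m^n≢0 D K {{D≢0}}}})
      swap-front : ∀ x y z → x * (y * z) ≡ y * (x * z)
      swap-front x y z = trans (sym (*-assoc x y z)) (trans (cong (_* z) (*-comm x y)) (*-assoc y x z))

-- Enumerating copies, and the uniform mass

module Attained where

  open PowerSums
  open Counting
  open Bound
  open import Data.Nat as ℕ using (ℕ; zero; suc)
  import Data.Nat.Properties as ℕ
  open import Data.Integer as ℤ using ()
  open import Data.Rational
  open import Data.Rational.Properties using (≤-antisym; ≤-refl; nonNegative⁻¹; normalize-nonNeg; *-comm; *-zeroˡ; *-identityˡ; +-identityʳ)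
  open import Data.Bool using (true; false; if_then_else_)
  import Data.Bool as Bool
  open import Data.Fin as Fin using (Fin; toℕ)
  import Data.Fin.Properties as Fin
  open import Data.Vec using (Vec; []; _∷_; lookup; tabulate)
  open import Data.Vec.Properties using (lookup∘tabulate; ≡-dec)
  open import Data.List using (List; []; _∷_; map; filter; allFin; cartesianProductWith; deduplicate)
  open import Data.List.Membership.Propositional using (_∈_)
  open import Data.List.Membership.Propositional.Properties
  open import Data.List.Relation.Unary.Any using (here)
  open import Data.List.Relation.Unary.Unique.DecPropositional.Properties using (deduplicate-!)
  open import Data.Product using (∃; Σ; _×_; _,_; proj₁; proj₂)
  open import Relation.Nullary using (Dec; yes; does)
  open import Relation.Nullary.Decidable using (_×-dec_; _→-dec_; dec-true)
  open import Relation.Binary.Definitions using (DecidableEquality)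
  open import Relation.Binary.PropositionalEquality

  does-true⇒ : ∀ {P : Set} (P? : Dec P) → does P? ≡ true → P
  does-true⇒ (yes p) _ = p

  module _ {n : ℕ} (H : Graph n) (N : ℕ) where

    IsImageArc : (Fin n → Fin N) → Fin N → Fin N → Set
    IsImageArc f a b = Σ (Fin n) λ i → Σ (Fin n) λ j → f i ≡ a × f j ≡ b × adj H i j ≡ true

    isImageArc? : ∀ f a b → Dec (IsImageArc f a b)
    isImageArc? f a b = Fin.any? λ i → Fin.any? λ j → (f i Fin.≟ a) ×-dec (f j Fin.≟ b) ×-dec (adj H i j Bool.≟ true)

    -- Vertex maps are vectors here because vectors, unlike functions, can be listed exhaustively up
    -- to propositional equality.
    image : Vec (Fin N) n → Graph N
    image v = tabulate λ a → tabulate λ b → does (isImageArc? (lookup v) a b)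

    adj-image : ∀ v a b → adj (image v) a b ≡ does (isImageArc? (lookup v) a b)
    adj-image v a b = trans (cong (λ row → lookup row b) (lookup∘tabulate _ a)) (lookup∘tabulate _ b)

    InjectiveVec : Vec (Fin N) n → Set
    InjectiveVec v = (i j : Fin n) → lookup v i ≡ lookup v j → i ≡ j

    injectiveVec? : ∀ v → Dec (InjectiveVec v)
    injectiveVec? v = Fin.all? λ i → Fin.all? λ j → (lookup v i Fin.≟ lookup v j) →-dec (i Fin.≟ j)

    image-copy : ∀ v → InjectiveVec v → IsCopy H (image v)
    image-copy v inj = lookup v , inj , λ a b →
      (λ p → does-true⇒ (isImageArc? (lookup v) a b) (trans (sym (adj-image v a b)) p)) ,
      (λ q → trans (adj-image v a b) (dec-true (isImageArc? (lookup v) a b) q))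

    copy-image : ∀ G → IsCopy H G → ∃ λ v → InjectiveVec v × G ≡ image v
    copy-image G (f , inj , spec) = v , inj′ , graph-ext λ a b → trans
      (bool-ext (λ p → let i , j , fi , fj , q = proj₁ (spec a b) p in
                       dec-true (isImageArc? (lookup v) a b) (i , j , trans (v-f i) fi , trans (v-f j) fj , q))
                (λ p → let i , j , fi , fj , q = does-true⇒ (isImageArc? (lookup v) a b) p in
                       proj₂ (spec a b) (i , j , trans (sym (v-f i)) fi , trans (sym (v-f j)) fj , q)))
      (sym (adj-image v a b))
      where
      v = tabulate f
      v-f : ∀ i → lookup v i ≡ f i
      v-f = lookup∘tabulate f
      inj′ : InjectiveVec v
      inj′ i j eq = inj i j (trans (sym (v-f i)) (trans eq (v-f j)))

    allVecs : ∀ l → List (Vec (Fin N) l)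
    allVecs zero    = [] ∷ []
    allVecs (suc l) = cartesianProductWith _∷_ (allFin N) (allVecs l)

    ∈-allVecs : ∀ {l} (v : Vec (Fin N) l) → v ∈ allVecs l
    ∈-allVecs []      = here refl
    ∈-allVecs (x ∷ v) = ∈-cartesianProductWith⁺ _∷_ (∈-allFin x) (∈-allVecs v)

    _≟ᴳ_ : DecidableEquality (Graph N)
    _≟ᴳ_ = ≡-dec (≡-dec Bool._≟_)

    images : List (Graph N)
    images = map image (filter injectiveVec? (allVecs n))

    -- Injections that differ by an automorphism of `H` have the same image, so repetitions have to
    -- be removed.
    copies : List (Graph N)
    copies = deduplicate _≟ᴳ_ images

    copies-enumerates : Enumerates H copies
    copies-enumerates = deduplicate-! _≟ᴳ_ images , λ G → sound G , complete G
      where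
      sound : ∀ G → G ∈ copies → IsCopy H G
      sound G G∈ with v , v∈ , refl ← ∈-map⁻ image (∈-deduplicate⁻ _≟ᴳ_ images G∈) =
        image-copy v (proj₂ (∈-filter⁻ injectiveVec? {xs = allVecs n} v∈))
      complete : ∀ G → IsCopy H G → G ∈ copies
      complete G copy with v , inj , refl ← copy-image G copy =
        ∈-deduplicate⁺ _≟ᴳ_ (∈-map⁺ image (∈-filter⁺ injectiveVec? (∈-allVecs v) inj))

  self-copy : ∀ {n} (H : Graph n) → IsCopy H H
  self-copy H = (λ i → i) , (λ i j eq → eq) , λ a b →
    (λ p → a , b , refl , refl , p) , λ { (_ , _ , refl , refl , p) → p }

  module _ {n : ℕ} (H : Graph n) (m : ℕ) (edges : edgeCount H ≡ suc m) where

    private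
      u : ℚ
      u = ℤ.+ 1 / suc m

      u≥0 : 0ℚ ≤ u
      u≥0 = nonNegative⁻¹ u {{normalize-nonNeg 1 (suc m)}}

    uniform : Fin n → Fin n → ℚ
    uniform a b = if edge? H (a , b) then u else 0ℚ

    uniform-nonNeg : ∀ a b → 0ℚ ≤ uniform a b
    uniform-nonNeg a b with edge? H (a , b)
    ... | true  = u≥0
    ... | false = ≤-refl

    uniform-probMass : IsProbMass uniform
    uniform-probMass = (λ a b _ → uniform-nonNeg a b) , (begin
      sumℚ n (λ a → sumℚ n (λ b → if toℕ a ℕ.<ᵇ toℕ b then uniform a b else 0ℚ))
                                  ≡⟨ sumℚ-ι-* n u _ _ (λ a → sumℚ-ι-* n u _ _ (term a)) ⟩
      ι (edgeCount H) * u         ≡⟨ cong (λ e → ι e * u) edges ⟩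
      ι (suc m) * u               ≡⟨ *-comm (ι (suc m)) u ⟩
      u * ι (suc m)               ≡⟨ fraction-* 1 m ⟩
      ι 1                         ≡⟨ +-identityʳ 1ℚ ⟩
      1ℚ                          ∎)
      where
      open ≡-Reasoning
      term : ∀ a b → (if toℕ a ℕ.<ᵇ toℕ b then uniform a b else 0ℚ) ≡ ι (if edge? H (a , b) then 1 else 0) * u
      term a b with adj H a b | toℕ a ℕ.<ᵇ toℕ b
      ... | true  | true  = sym (trans (cong (_* u) (+-identityʳ 1ℚ)) (*-identityˡ u))
      ... | true  | false = sym (*-zeroˡ u)
      ... | false | true  = sym (*-zeroˡ u)
      ... | false | false = sym (*-zeroˡ u)

    weight-uniform : weight uniform H ≡ powℚ u (edgeCount H)
    weight-uniform = prodℚ-powℚ n u _ _ (λ a → prodℚ-powℚ n u _ _ (factor a))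
      where
      factor : ∀ a b → (if edge? H (a , b) then uniform a b else 1ℚ) ≡ powℚ u (if edge? H (a , b) then 1 else 0)
      factor a b with edge? H (a , b)
      ... | true  = trans (sym (*-identityˡ u)) (*-comm 1ℚ u)
      ... | false = refl

    -- Only the term of `H` itself is evaluated; the other copies contribute nonnegative terms, and
    -- `betaList-≤` then forces equality.
    invPow≤betaList : ∀ k {L} → Enumerates H L → invPow (edgeCount H) (k ℕ.* edgeCount H) ≤ betaList uniform k L
    invPow≤betaList k {L} (_ , enum) = subst (_≤ betaList uniform k L) value
      (betaList-∈ uniform k (λ G → weight-nonNeg uniform G (λ a b _ → uniform-nonNeg a b))
        (proj₂ (enum H) (self-copy H)))
      where
      value : powℚ (weight uniform H) k ≡ invPow (edgeCount H) (k ℕ.* edgeCount H)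
      value = trans (cong (λ z → powℚ z k) weight-uniform)
             (trans (powℚ-powℚ u (edgeCount H) k)
                      (cong (λ e → invPow e (k ℕ.* edgeCount H)) (sym edges)))

  attained : ∀ {n} (H : Graph n) → IsSimple H → 1 ℕ.≤ edgeCount H → ∀ k → 1 ℕ.≤ k →
    (edgeCount H ℕ.+ 1) ℕ.* edgeCount H ℕ.^ (k ℕ.* edgeCount H) ℕ.≤ (edgeCount H ℕ.+ 1) ℕ.^ (k ℕ.* edgeCount H) →
    Σ (Fin n → Fin n → ℚ) λ μ → IsProbMass μ × Σ (List (Graph n)) λ L →
      Enumerates H L × betaList μ k L ≡ invPow (edgeCount H) (k ℕ.* edgeCount H)
  attained {n} H simple 1≤m k 1≤k hyp = μ , mass , copies H n , enum ,
    ≤-antisym (betaList-≤ μ mass H simple 1≤m k 1≤k hyp (copies H n) enum) (invPow≤betaList H m edges k enum)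
    where
    m = ℕ.pred (edgeCount H)
    edges : edgeCount H ≡ suc m
    edges = sym (ℕ.suc-pred (edgeCount H) {{ℕ.>-nonZero 1≤m}})
    μ = uniform H m edges
    mass = uniform-probMass H m edges
    enum = copies-enumerates H n

open import Data.Nat using (ℕ; _+_; _*_; _^_)
import Data.Nat as ℕ
open import Data.Fin using (Fin)
open import Data.List using (List)
open import Data.Product using (Σ; _×_; _,_)
open import Data.Rational using (ℚ; _≤_)
open import Relation.Binary.PropositionalEquality using (_≡_)

theorem4p11 : (n : ℕ) (H : Graph n) → IsSimple H → NoIsolated H →
    1 ℕ.≤ edgeCount H → (k : ℕ) → 1 ℕ.≤ k →
    (edgeCount H + 1) * edgeCount H ^ (k * edgeCount H) ℕ.≤ (edgeCount H + 1) ^ (k * edgeCount H) →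
    ((N : ℕ) (μ : Fin N → Fin N → ℚ) → IsProbMass μ → (L : List (Graph N)) → Enumerates H L →
    betaList μ k L ≤ invPow (edgeCount H) (k * edgeCount H))
    × Σ ℕ (λ N → Σ (Fin N → Fin N → ℚ) (λ μ → IsProbMass μ × Σ (List (Graph N)) (λ L →
    Enumerates H L × betaList μ k L ≡ invPow (edgeCount H) (k * edgeCount H))))
theorem4p11 n H simple _ 1≤m k 1≤k hyp =
  (λ N μ mass L enum → Bound.betaList-≤ μ mass H simple 1≤m k 1≤k hyp L enum) ,
  n , Attained.attained H simple 1≤m k 1≤k hyp
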